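{- Let $n\ge 3$, let $W_{\mathrm{aff}}$ be the affine Weyl group of type $A_{n-1}^{(1)}$, let $w\in W_{\mathrm{aff}}$ and let $\mathbf d=(d_0,\dots,d_{n-1})\in\mathbb Z_{\ge 0}^n$ be any degree. Then $$\Gamma_{\mathbf d}(w)=\max\{\,w\cdot u : u\in\Gamma_{\mathbf d}(id)\,\},$$ where $\cdot$ is the Hecke product and $\max$ of a set denotes its subset of maximal elements in the Bruhat order.
   Context: Roots. Let $n\ge 3$. Let $\alpha_0,\dots,\alpha_{n-1}$ (indices mod $n$) be the affine simple roots of type $A_{n-1}^{(1)}$, $Q_{\mathrm{aff}}=\bigoplus_{i=0}^{n-1}\mathbb Z\alpha_i$, with symmetric form $\langle\alpha_i,\alpha_i\rangle=2$, $\langle\alpha_i,\alpha_{i\pm1}\rangle=-1$, all other $\langle\alpha_i,\alpha_j\rangle=0$. Put $c=\sum_{i=0}^{n-1}\alpha_i$ (identified with the imaginary root $\delta$). Let $\Pi=\Pi^+\sqcup\Pi^-$ be the finite root system of type $A_{n-1}$ with simple roots $\alpha_1,\dots,\alpha_{n-1}$. The affine real roots are $\alpha+mc$ with $\alpha\in\Pi$, $m\in\mathbb Z$; such a root is positive if $m>0$, or $m=0$ and $\alpha\in\Pi^+$. The set of positive real roots is $\Pi_{\mathrm{aff}}^{\mathrm{re},+}$. Weyl group. For a real root $\alpha$, $s_\alpha(\mu)=\mu-\langle\mu,\alpha\rangle\alpha$. $W_{\mathrm{aff}}$ is the group generated by $s_i=s_{\alpha_i}$, $0\le i\le n-1$ (a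 Coxeter group with these generators), with length $\ell$ and Bruhat order $\le$. Hecke product: $u\cdot s_i=us_i$ if $\ell(us_i)>\ell(u)$ and $u\cdot s_i=u$ otherwise; $u\cdot v=u\cdot s_{i_1}\cdots s_{i_k}$ (applied left to right) for any reduced expression $v=s_{i_1}\cdots s_{i_k}$. This is a well-defined associative product. Curve neighborhoods. The moment graph has vertex set $W_{\mathrm{aff}}$ and an edge $u\stackrel{\alpha}{\longrightarrow}us_\alpha$ of degree $\alpha$ for each $u\in W_{\mathrm{aff}}$, $\alpha\in\Pi_{\mathrm{aff}}^{\mathrm{re},+}$. The degree of a chain (a succession of adjacent edges, possibly empty) is the sum of the degrees of its edges. A degree is a tuple $\mathbf d=(d_0,\dots,d_{n-1})\in\mathbb Z_{\ge0}^n$, identified with $\sum d_i\alpha_i$; degrees are ordered componentwise. For $u\in W_{\mathrm{aff}}$, $\Gamma_{\mathbf d}(u)$ is the set of Bruhat-maximal elements of the set of all $v\in W_{\mathrm{aff}}$ that can be joined to some $u'\le u$ by a chain of degree $\le\mathbf d$. -}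

module Defs where

open import Data.Bool.Base using (if_then_else_; _∧_)
open import Data.Fin.Base using (Fin; zero; suc; toℕ)
open import Data.Fin.Properties as Fin using (any?; all?)
open import Data.Integer.Base as ℤ using (ℤ; 0ℤ; 1ℤ; -1ℤ; +_)
import Data.Integer.Properties as ℤ
open import Data.Integer.Tactic.RingSolver using (solve-∀)
open import Data.List.Base using (List; []; _∷_; _∷ʳ_; length; foldl)
open import Data.Nat.Base as ℕ using (ℕ; zero; suc)
import Data.Nat.Properties as ℕ
open import Data.Product.Base using (∃; _×_; _,_; proj₁; proj₂)
open import Data.Sum.Base using (_⊎_)
open import Function.Base using (_∘_)
open import Level using (0ℓ)
open import Relation.Binary.Construct.Closure.ReflexiveTransitive using (Star)
open import Relation.Binary.Construct.Union using (_∪_)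
open import Relation.Binary.Definitions using (Decidable)
open import Relation.Binary.PropositionalEquality
  using (_≡_; _≗_; refl; sym; trans; cong; cong₂; subst; module ≡-Reasoning)
open import Relation.Nullary.Decidable
  using (Dec; yes; no; does; map′; _×-dec_; _⊎-dec_)
open import Relation.Unary using (Pred)

open import Algebra.Properties.Semiring.Sum ℤ.+-*-semiring
  using (sum; sum-syntax; sum-cong-≗; ∑-distrib-+; *-distribˡ-sum; sum-replicate-zero)

module AffineA (n : ℕ) where

  -- Q_aff, in coordinates with respect to α₀, …, αₙ₋₁; compared with _≗_.
  Q : Set
  Q = Fin n → ℤ

  α : Fin n → Q
  α i j = if does (i Fin.≟ j) then 1ℤ else 0ℤ

  -- j ≡ i + 1 mod n
  Next : Fin n → Fin n → Set
  Next i j = suc (toℕ i) ≡ toℕ j ⊎ (suc (toℕ i) ≡ n × toℕ j ≡ 0)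

  next? : ∀ i j → Dec (Next i j)
  next? i j = (suc (toℕ i) ℕ.≟ toℕ j) ⊎-dec ((suc (toℕ i) ℕ.≟ n) ×-dec (toℕ j ℕ.≟ 0))

  -- ⟨ αᵢ , αⱼ ⟩ ; for n ≥ 3 the indices i - 1, i, i + 1 are distinct mod n.
  cartan : Fin n → Fin n → ℤ
  cartan i j =
    if does (i Fin.≟ j) then + 2
    else if does (next? i j ⊎-dec next? j i) then -1ℤ
    else 0ℤ

  ⟨_,_⟩ : Q → Q → ℤ
  ⟨ μ , ν ⟩ = ∑[ i < n ] ∑[ j < n ] (μ i ℤ.* (ν j ℤ.* cartan i j))

  s : Q → Q → Q
  s β μ k = μ k ℤ.- ⟨ μ , β ⟩ ℤ.* β k

  c : Q
  c _ = 1ℤ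

  -- αᵢ + αᵢ₊₁ + … + αⱼ
  interval : Fin n → Fin n → Q
  interval i j k =
    if does (toℕ i ℕ.≤? toℕ k) ∧ does (toℕ k ℕ.≤? toℕ j) then 1ℤ else 0ℤ

  Π⁺ : Pred Q 0ℓ
  Π⁺ β = ∃ λ i → ∃ λ j → 1 ℕ.≤ toℕ i × toℕ i ℕ.≤ toℕ j × β ≗ interval i j

  Π : Pred Q 0ℓ
  Π β = Π⁺ β ⊎ Π⁺ (ℤ.-_ ∘ β)

  PositiveRealRoot : Pred Q 0ℓ
  PositiveRealRoot γ =
    ∃ λ β → ∃ λ (m : ℤ) →
      Π β × (0ℤ ℤ.< m ⊎ (m ≡ 0ℤ × Π⁺ β)) × (∀ k → γ k ≡ β k ℤ.+ m ℤ.* c k)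

  -- The group generated by the involutions sᵢ acting on Q: an element is
  -- given by a word in the generators, and two words are identified (_≈_)
  -- when they act in the same way.  The word i₁ ∷ … ∷ iₖ ∷ [] stands for
  -- sᵢ₁ ⋯ sᵢₖ, the product in the group is concatenation, and u ∷ʳ i is u sᵢ.
  W : Set
  W = List (Fin n)

  infixr 8 _▷_
  _▷_ : W → Q → Q
  []      ▷ μ = μ
  (i ∷ w) ▷ μ = s (α i) (w ▷ μ)

  infix 4 _≈_
  _≈_ : W → W → Set
  u ≈ v = ∀ μ → u ▷ μ ≗ v ▷ μ

  id : W
  id = []

  -- Deciding _≈_: the action is linear, so it is enough to compare the
  -- images of the simple roots.

  record Linear (f : Q → Q) : Set where
    field
      f-cong : ∀ {μ ν} → μ ≗ ν → f μ ≗ f ν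
      f-+    : ∀ μ ν k → f (λ l → μ l ℤ.+ ν l) k ≡ f μ k ℤ.+ f ν k
      f-*    : ∀ a μ k → f (λ l → a ℤ.* μ l) k ≡ a ℤ.* f μ k

  open Linear

  private
    form-cong : ∀ {μ ν} β → μ ≗ ν → ⟨ μ , β ⟩ ≡ ⟨ ν , β ⟩
    form-cong β eq = sum-cong-≗ λ i → sum-cong-≗ λ j →
      cong (ℤ._* (β j ℤ.* cartan i j)) (eq i)

    form-+ : ∀ β μ ν → ⟨ (λ l → μ l ℤ.+ ν l) , β ⟩ ≡ ⟨ μ , β ⟩ ℤ.+ ⟨ ν , β ⟩
    form-+ β μ ν = trans
      (sum-cong-≗ λ i → trans
        (sum-cong-≗ λ j → ℤ.*-distribʳ-+ (β j ℤ.* cartan i j) (μ i) (ν i))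
        (∑-distrib-+ (λ j → μ i ℤ.* (β j ℤ.* cartan i j))
                     (λ j → ν i ℤ.* (β j ℤ.* cartan i j))))
      (∑-distrib-+ (λ i → ∑[ j < n ] (μ i ℤ.* (β j ℤ.* cartan i j)))
                   (λ i → ∑[ j < n ] (ν i ℤ.* (β j ℤ.* cartan i j))))

    form-* : ∀ β a μ → ⟨ (λ l → a ℤ.* μ l) , β ⟩ ≡ a ℤ.* ⟨ μ , β ⟩
    form-* β a μ = sym (trans
      (*-distribˡ-sum a (λ i → ∑[ j < n ] (μ i ℤ.* (β j ℤ.* cartan i j))))
      (sum-cong-≗ λ i → trans
        (*-distribˡ-sum a (λ j → μ i ℤ.* (β j ℤ.* cartan i j)))
        (sum-cong-≗ λ j → sym (ℤ.*-assoc a (μ i) (β j ℤ.* cartan i j)))))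

    arith₁ : ∀ x y p q b →
      (x ℤ.+ y) ℤ.- (p ℤ.+ q) ℤ.* b ≡ (x ℤ.- p ℤ.* b) ℤ.+ (y ℤ.- q ℤ.* b)
    arith₁ = solve-∀

    arith₂ : ∀ a x p b →
      a ℤ.* x ℤ.- (a ℤ.* p) ℤ.* b ≡ a ℤ.* (x ℤ.- p ℤ.* b)
    arith₂ = solve-∀

  s-linear : ∀ β → Linear (s β)
  s-linear β .f-cong eq k =
    cong₂ (λ x p → x ℤ.- p ℤ.* β k) (eq k) (form-cong β eq)
  s-linear β .f-+ μ ν k = trans
    (cong (λ p → (μ k ℤ.+ ν k) ℤ.- p ℤ.* β k) (form-+ β μ ν))
    (arith₁ (μ k) (ν k) ⟨ μ , β ⟩ ⟨ ν , β ⟩ (β k))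
  s-linear β .f-* a μ k = trans
    (cong (λ p → a ℤ.* μ k ℤ.- p ℤ.* β k) (form-* β a μ))
    (arith₂ a (μ k) ⟨ μ , β ⟩ (β k))

  ▷-linear : ∀ w → Linear (w ▷_)
  ▷-linear [] .f-cong eq   = eq
  ▷-linear [] .f-+ _ _ _   = refl
  ▷-linear [] .f-* _ _ _   = refl
  ▷-linear (i ∷ w) .f-cong eq = s-linear (α i) .f-cong (▷-linear w .f-cong eq)
  ▷-linear (i ∷ w) .f-+ μ ν k = trans
    (s-linear (α i) .f-cong (▷-linear w .f-+ μ ν) k)
    (s-linear (α i) .f-+ (w ▷ μ) (w ▷ ν) k)
  ▷-linear (i ∷ w) .f-* a μ k = trans
    (s-linear (α i) .f-cong (▷-linear w .f-* a μ) k)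
    (s-linear (α i) .f-* a (w ▷ μ) k)

  private
    linear-sum : ∀ {f} → Linear f → ∀ {m} (F : Fin m → Q) k →
      f (λ l → ∑[ j < m ] F j l) k ≡ ∑[ j < m ] f (F j) k
    linear-sum L {zero}  F k = L .f-* 0ℤ (λ _ → 0ℤ) k
    linear-sum {f} L {suc m} F k = trans
      (L .f-+ (F zero) (λ l → ∑[ j < m ] F (suc j) l) k)
      (cong (λ x → f (F zero) k ℤ.+ x) (linear-sum L (F ∘ suc) k))

    sum-δ : ∀ {m} (μ : Fin m → ℤ) k →
      ∑[ j < m ] (μ j ℤ.* (if does (j Fin.≟ k) then 1ℤ else 0ℤ)) ≡ μ k
    sum-δ {suc m} μ zero = trans
      (cong₂ ℤ._+_ (ℤ.*-identityʳ (μ zero))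
        (trans (sum-cong-≗ λ j → ℤ.*-zeroʳ (μ (suc j))) (sum-replicate-zero m)))
      (ℤ.+-identityʳ (μ zero))
    sum-δ {suc m} μ (suc k) = trans
      (cong₂ ℤ._+_ (ℤ.*-zeroʳ (μ zero)) (sum-δ (μ ∘ suc) k))
      (ℤ.+-identityˡ (μ (suc k)))

    expand : ∀ {f} → Linear f → ∀ μ k → f μ k ≡ ∑[ j < n ] (μ j ℤ.* f (α j) k)
    expand L μ k = trans (L .f-cong (λ l → sym (sum-δ μ l)) k)
      (trans (linear-sum L (λ j l → μ j ℤ.* α j l) k)
             (sum-cong-≗ λ j → L .f-* (μ j) (α j) k))

  _≈?_ : Decidable _≈_
  u ≈? v = map′
    (λ eq μ k → trans (expand (▷-linear u) μ k)
      (trans (sum-cong-≗ λ j → cong (μ j ℤ.*_) (eq j k))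
             (sym (expand (▷-linear v) μ k))))
    (λ eq j → eq (α j))
    (all? λ j → all? λ k → (u ▷ α j) k ℤ.≟ (v ▷ α j) k)

  IsReducedExpressionOf : W → W → Set
  IsReducedExpressionOf r w = r ≈ w × (∀ u → u ≈ w → length r ℕ.≤ length u)

  private
    word? : ∀ k {P : Pred W 0ℓ} → (∀ u → Dec (P u)) → Dec (∃ λ u → length u ≡ k × P u)
    word? zero P? = map′ (λ p → [] , refl , p) (λ { ([] , _ , p) → p }) (P? [])
    word? (suc k) P? = map′
      (λ { (i , u , eq , p) → i ∷ u , cong suc eq , p })
      (λ { (i ∷ u , eq , p) → i , u , ℕ.suc-injective eq , p })
      (any? λ i → word? k (λ u → P? (i ∷ u)))

    search : ∀ w k f → k ℕ.+ f ≡ length w → (∀ u → u ≈ w → k ℕ.≤ length u) →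
      ∃ λ r → IsReducedExpressionOf r w
    search w k zero eq low = w , (λ _ _ → refl) ,
      λ u u≈w → subst (ℕ._≤ length u) (trans (sym (ℕ.+-identityʳ k)) eq) (low u u≈w)
    search w k (suc f) eq low with word? k (_≈? w)
    ... | yes (r , refl , r≈w) = r , r≈w , low
    ... | no none = search w (suc k) f (trans (sym (ℕ.+-suc k f)) eq)
      λ u u≈w → ℕ.≤∧≢⇒< (low u u≈w) λ k≡ → none (u , sym k≡ , u≈w)

  reduce : ∀ w → ∃ λ r → IsReducedExpressionOf r w
  reduce w = search w 0 (length w) refl (λ _ _ → ℕ.z≤n)

  reduced : W → W
  reduced w = proj₁ (reduce w)

  ℓ : W → ℕ
  ℓ w = length (reduced w)

  infixl 7 _·ₛ_ _·_
  _·ₛ_ : W → Fin n → W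
  u ·ₛ i = if does (ℓ u ℕ.<? ℓ (u ∷ʳ i)) then u ∷ʳ i else u

  -- Up to _≈_ the result does not depend on the reduced expression of v.
  _·_ : W → W → W
  u · v = foldl _·ₛ_ u (reduced v)

  -- v = u s_γ with γ a positive real root
  Edge : W → Q → W → Set
  Edge u γ v = PositiveRealRoot γ × (∀ μ → v ▷ μ ≗ u ▷ s γ μ)

  infix 4 _→ᴮ_ _≤ᴮ_
  _→ᴮ_ : W → W → Set
  u →ᴮ v = (∃ λ γ → Edge u γ v) × ℓ u ℕ.< ℓ v

  _≤ᴮ_ : W → W → Set
  _≤ᴮ_ = Star (_≈_ ∪ _→ᴮ_)

  Max : Pred W 0ℓ → Pred W 0ℓ
  Max P v = P v × (∀ x → P x → v ≤ᴮ x → x ≈ v)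

  -- Chains indexed by their degree.  Edges are undirected, but every edge
  -- u — u s_γ occurs in both orientations with the same degree.
  data Chain : W → W → Q → Set where
    nil  : ∀ {u v} → u ≈ v → Chain u v (λ _ → 0ℤ)
    cons : ∀ {u v w γ δ} → Edge u γ v → Chain v w δ → Chain u w (λ k → γ k ℤ.+ δ k)

  Degree : Set
  Degree = Fin n → ℕ

  Reachable : Degree → W → Pred W 0ℓ
  Reachable d u v =
    ∃ λ u′ → u′ ≤ᴮ u × ∃ λ δ → Chain u′ v δ × (∀ k → δ k ℤ.≤ + d k)

  Γ : Degree → W → Pred W 0ℓ
  Γ d u = Max (Reachable d u)

{-# OPTIONS --safe #-}
module Submission where

open import Defs
open import Algebra.Properties.AbelianGroup using (∙-cancelʳ; ∙-cancelˡ)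
open import Data.Bool.Base using (true; false; if_then_else_; _∧_)
open import Data.Fin.Base using (Fin; zero; suc; toℕ; fromℕ; fromℕ<; inject₁; finToFun; funToFin)
import Data.Fin.Properties as Fin
open import Data.Fin.Relation.Unary.Top using (view; ‵fromℕ; ‵inject₁; view-fromℕ; view-inject₁)
open import Data.Integer.Base as ℤ
  using (ℤ; 0ℤ; 1ℤ; -1ℤ; +_; -[1+_]; _+_; _*_; _-_; -_; ∣_∣; +≤+; -≤+)
import Data.Integer.Properties as ℤ
open import Data.Integer.Tactic.RingSolver using (solve-∀)
open import Data.List.Base
  using (List; []; _∷_; _∷ʳ_; _++_; reverse; length; foldl; map; concat; tabulate)
open import Data.List.Properties
  using (unfold-reverse; length-++; ++-assoc; ++-identityʳ; foldl-++; foldl-∷ʳ)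
open import Data.List.Relation.Unary.All as All using (All; []; _∷_)
import Data.List.Relation.Unary.All.Properties as All
open import Data.List.Relation.Unary.Any as Any using (Any; here; there)
import Data.List.Relation.Unary.Any.Properties as Any
open import Data.List.Reverse using (Reverse; reverseView; []; _∶_∶ʳ_)
open import Data.Nat.Base as ℕ using (ℕ; zero; suc; s≤s; z≤n; _≤_)
import Data.Nat.Properties as ℕ
open import Data.Product.Base using (∃; _×_; _,_; proj₁; proj₂)
open import Data.Sum.Base using (_⊎_; inj₁; inj₂; [_,_]′)
open import Function.Base using (_∘_)
open import Relation.Binary.Construct.Closure.ReflexiveTransitive using (ε; _◅_; _◅◅_)
open import Relation.Binary.Definitions using (tri<; tri≈; tri>)
open import Relation.Binary.PropositionalEquality
  using (_≡_; _≢_; _≗_; refl; sym; trans; cong; cong₂; subst; subst₂; module ≡-Reasoning)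
open import Relation.Nullary using (¬_; contradiction)
open import Relation.Nullary.Decidable
  using (Dec; yes; no; does; dec-true; dec-false; map′; _×-dec_; _⊎-dec_)
open import Relation.Unary using (_∈_; _≐_)

open import Algebra.Properties.Semiring.Sum ℤ.+-*-semiring
  using (sum; sum-syntax; sum-cong-≗; ∑-distrib-+; ∑-comm; *-distribˡ-sum;
         sum-replicate-zero; sum-init-last)

-- A chain of degree ≤ d from u′ ends in u′ x, where x = s_γ₁ ⋯ s_γₖ is reachable
-- from the identity, so everything reduces to the two bounds u′ x ≤ w · x for
-- u′ ≤ w, and w · x = w′ x for some w′ ≤ w.  As w · x is monotone in x, only the
-- maximal x matter.  The Bruhat order is controlled by the sign of u γ: the affine
-- real roots are exactly the vectors of norm 2, since the form is the cyclic sum of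
-- (μᵢ - μᵢ₊₁)², and so each of them is positive or negative and W permutes them.
-- Maximal elements exist constructively because the set of elements reachable from
-- the identity is finite and the Bruhat order is decidable.

-- An element of `W` is a word up to `≈`, and `w · x` is computed along the one shortest word for
-- `x` that the search returns. That the choice of word is immaterial is not derived from braid
-- relations. One inequality takes its place: folding `_·ₛ_` from `w` along any word for `x`,
-- reduced or not, gives an element above `w · x`. For if `w · x = w′ x` with `w′ ≤ w`, then `w′`
-- followed by that word is an ordinary product, and ordinary products lie below Hecke products.
-- Monotonicity in `x` needs exactly this generality, since deleting a letter from a reduced word
-- may leave a word that is not reduced. The existence of maximal elements is needed because the
-- theorem lets `u` range over `Γ d id` only: a reachable `x` must first be replaced by a maximal
-- element above it.

-- Cyclic successor and finite sums.

nxt : ∀ {n} → Fin n → Fin n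
nxt i with view i
... | ‵fromℕ     = zero
... | ‵inject₁ j = suc j

nxt-fromℕ : ∀ m → nxt (fromℕ m) ≡ zero
nxt-fromℕ m rewrite view-fromℕ m = refl

nxt-inject₁ : ∀ {m} (i : Fin m) → nxt (inject₁ i) ≡ suc i
nxt-inject₁ i rewrite view-inject₁ i = refl

-- The wrap-around term, split off at the end, is the term `f zero` missing at the front.
sum-nxt : ∀ {n} (f : Fin n → ℤ) → sum (f ∘ nxt) ≡ sum f
sum-nxt {zero}  f = refl
sum-nxt {suc m} f = begin
  sum (f ∘ nxt)                                ≡⟨ sum-init-last (f ∘ nxt) ⟩
  sum (f ∘ nxt ∘ inject₁) + f (nxt (fromℕ m))
    ≡⟨ cong₂ _+_ (sum-cong-≗ (cong f ∘ nxt-inject₁)) (cong f (nxt-fromℕ m)) ⟩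
  sum (f ∘ suc) + f zero                       ≡⟨ ℤ.+-comm (sum (f ∘ suc)) (f zero) ⟩
  sum f                                        ∎
  where open ≡-Reasoning

-- With the order `k ≟ j` the indicator is `α k j` by definition, so this evaluates every sum
-- against a simple root.
∑-*-indicator : ∀ {m} (f : Fin m → ℤ) k →
  ∑[ j < m ] (f j * (if does (k Fin.≟ j) then 1ℤ else 0ℤ)) ≡ f k
∑-*-indicator {suc m} f zero = trans
  (cong₂ _+_ (ℤ.*-identityʳ (f zero))
    (trans (sum-cong-≗ λ j → ℤ.*-zeroʳ (f (suc j))) (sum-replicate-zero m)))
  (ℤ.+-identityʳ (f zero))
∑-*-indicator {suc m} f (suc k) = trans
  (cong₂ _+_ (ℤ.*-zeroʳ (f zero)) (∑-*-indicator (f ∘ suc) k))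
  (ℤ.+-identityˡ (f (suc k)))

∑∑-distrib-+ : ∀ {m n} (f g : Fin m → Fin n → ℤ) →
  ∑[ i < m ] ∑[ j < n ] (f i j + g i j) ≡ ∑[ i < m ] ∑[ j < n ] f i j + ∑[ i < m ] ∑[ j < n ] g i j
∑∑-distrib-+ f g = trans (sum-cong-≗ λ i → ∑-distrib-+ (f i) (g i))
  (∑-distrib-+ (λ i → sum (f i)) (λ i → sum (g i)))

-- The form as a cyclic sum, reflections, and the isometric action of words.

module Form (n : ℕ) (n≥3 : 3 ℕ.≤ n) where

  open AffineA n

  α-diag : ∀ i → α i i ≡ 1ℤ
  α-diag i = cong (if_then 1ℤ else 0ℤ) (dec-true (i Fin.≟ i) refl)

  α-off : ∀ {i j} → i ≢ j → α i j ≡ 0ℤ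
  α-off {i} {j} i≢j = cong (if_then 1ℤ else 0ℤ) (dec-false (i Fin.≟ j) i≢j)

  Next-nxt : ∀ i → Next i (nxt i)
  Next-nxt i with view i
  ... | ‵fromℕ     = inj₂ (cong suc (Fin.toℕ-fromℕ _) , refl)
  ... | ‵inject₁ j = inj₁ (cong suc (Fin.toℕ-inject₁ j))

  Next-functional : ∀ {i j j′} → Next i j → Next i j′ → j ≡ j′
  Next-functional (inj₁ p) (inj₁ q) = Fin.toℕ-injective (trans (sym p) q)
  Next-functional {j = j} (inj₁ p) (inj₂ (q , _)) =
    contradiction (trans (sym p) q) (ℕ.<⇒≢ (Fin.toℕ<n j))
  Next-functional {j′ = j′} (inj₂ (p , _)) (inj₁ q) =
    contradiction (trans (sym q) p) (ℕ.<⇒≢ (Fin.toℕ<n j′))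
  Next-functional (inj₂ (_ , p)) (inj₂ (_ , q)) = Fin.toℕ-injective (trans p (sym q))

  Next-irrefl : ∀ {i} → ¬ Next i i
  Next-irrefl (inj₁ p) = contradiction (sym p) (ℕ.<⇒≢ ℕ.≤-refl)
  Next-irrefl (inj₂ (p , q)) =
    contradiction (trans (cong suc (sym q)) p) (ℕ.<⇒≢ (ℕ.≤-trans (s≤s (s≤s z≤n)) n≥3))

  -- Here `n ≥ 3` is essential: two indices on a cycle of length 2 are successors of each other, and
  -- `cartan-split` would fail.
  Next-asym : ∀ {i j} → Next i j → ¬ Next j i
  Next-asym (inj₁ p) (inj₁ q) =
    contradiction (trans (sym q) (cong suc (sym p))) (ℕ.<⇒≢ (ℕ.m≤n⇒m≤1+n ℕ.≤-refl))
  Next-asym (inj₁ p) (inj₂ (q , r)) =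
    contradiction (trans (cong suc (trans (cong suc (sym r)) p)) q) (ℕ.<⇒≢ n≥3)
  Next-asym (inj₂ (q , r)) (inj₁ p) =
    contradiction (trans (cong suc (trans (cong suc (sym r)) p)) q) (ℕ.<⇒≢ n≥3)
  Next-asym (inj₂ (p , q)) (inj₂ (r , s)) =
    contradiction (trans (cong suc (sym q)) r) (ℕ.<⇒≢ (ℕ.≤-trans (s≤s (s≤s z≤n)) n≥3))

  cartan-diag : ∀ i → cartan i i ≡ + 2
  cartan-diag i = cong (if_then + 2 else if does (next? i i ⊎-dec next? i i) then -1ℤ else 0ℤ)
    (dec-true (i Fin.≟ i) refl)

  cartan-adjacent : ∀ {i j} → i ≢ j → Next i j ⊎ Next j i → cartan i j ≡ -1ℤ
  cartan-adjacent {i} {j} i≢j p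
    rewrite dec-false (i Fin.≟ j) i≢j | dec-true (next? i j ⊎-dec next? j i) p = refl

  cartan-distant : ∀ {i j} → i ≢ j → ¬ (Next i j ⊎ Next j i) → cartan i j ≡ 0ℤ
  cartan-distant {i} {j} i≢j ¬p
    rewrite dec-false (i Fin.≟ j) i≢j | dec-false (next? i j ⊎-dec next? j i) ¬p = refl

  α-nxt : ∀ i j → Next i j → α (nxt i) j ≡ 1ℤ
  α-nxt i j p = trans (cong (α (nxt i)) (Next-functional p (Next-nxt i))) (α-diag (nxt i))

  α-nxt-off : ∀ i j → ¬ Next i j → α (nxt i) j ≡ 0ℤ
  α-nxt-off i j ¬p = α-off λ eq → ¬p (subst (Next i) eq (Next-nxt i))

  -- The Cartan matrix is twice the identity minus the cyclic shift matrix and its transpose,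
  -- written without subtraction so that `form≡∑∂∂` can add the cross terms.
  cartan-split : ∀ i j → cartan i j + (α (nxt i) j + α (nxt j) i) ≡ α i j + α i j
  cartan-split i j = by-cases (i Fin.≟ j) (next? i j) (next? j i)
    where
    combine : ∀ {x y z w} → cartan i j ≡ x → α (nxt i) j ≡ y → α (nxt j) i ≡ z → α i j ≡ w →
      x + (y + z) ≡ w + w → cartan i j + (α (nxt i) j + α (nxt j) i) ≡ α i j + α i j
    combine refl refl refl refl eq = eq

    by-cases : Dec (i ≡ j) → Dec (Next i j) → Dec (Next j i) →
      cartan i j + (α (nxt i) j + α (nxt j) i) ≡ α i j + α i j
    by-cases (yes refl) _ _ =
      combine (cartan-diag i) (α-nxt-off i i Next-irrefl) (α-nxt-off i i Next-irrefl) (α-diag i) refl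
    by-cases (no i≢j) (yes p) _ =
      combine (cartan-adjacent i≢j (inj₁ p)) (α-nxt i j p) (α-nxt-off j i (Next-asym p)) (α-off i≢j) refl
    by-cases (no i≢j) (no ¬p) (yes q) =
      combine (cartan-adjacent i≢j (inj₂ q)) (α-nxt-off i j ¬p) (α-nxt j i q) (α-off i≢j) refl
    by-cases (no i≢j) (no ¬p) (no ¬q) =
      combine (cartan-distant i≢j λ { (inj₁ p) → ¬p p ; (inj₂ q) → ¬q q })
        (α-nxt-off i j ¬p) (α-nxt-off j i ¬q) (α-off i≢j) refl

  ∂ : Q → Q
  ∂ μ i = μ i - μ (nxt i)

  -- The form is Σ (μᵢ - μᵢ₊₁)(νᵢ - νᵢ₊₁); both sides are compared after adding
  -- the cross terms Σ μᵢ νᵢ₊₁ + Σ μᵢ₊₁ νᵢ.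
  form≡∑∂∂ : ∀ μ ν → ⟨ μ , ν ⟩ ≡ ∑[ i < n ] (∂ μ i * ∂ ν i)
  form≡∑∂∂ μ ν = ∙-cancelʳ ℤ.+-0-abelianGroup _ ⟨ μ , ν ⟩ _ (begin
    ⟨ μ , ν ⟩ + (∑[ i < n ] (μ i * ν (nxt i)) + ∑[ i < n ] (μ (nxt i) * ν i))
      ≡⟨ cong (λ x → ⟨ μ , ν ⟩ + x) (cong₂ _+_ cross₁ cross₂) ⟨
    ⟨ μ , ν ⟩ + (∑[ i < n ] ∑[ j < n ] (μ i * ν j * α (nxt i) j) + ∑[ i < n ] ∑[ j < n ] (μ i * ν j * α (nxt j) i))
      ≡⟨ cong (λ x → ⟨ μ , ν ⟩ + x) (∑∑-distrib-+ (λ i j → μ i * ν j * α (nxt i) j) (λ i j → μ i * ν j * α (nxt j) i)) ⟨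
    ⟨ μ , ν ⟩ + ∑[ i < n ] ∑[ j < n ] (μ i * ν j * α (nxt i) j + μ i * ν j * α (nxt j) i)
      ≡⟨ ∑∑-distrib-+ (λ i j → μ i * (ν j * cartan i j)) (λ i j → μ i * ν j * α (nxt i) j + μ i * ν j * α (nxt j) i) ⟨
    ∑[ i < n ] ∑[ j < n ] (μ i * (ν j * cartan i j) + (μ i * ν j * α (nxt i) j + μ i * ν j * α (nxt j) i))
      ≡⟨ (sum-cong-≗ λ i → sum-cong-≗ λ j → termwise i j) ⟩
    ∑[ i < n ] ∑[ j < n ] (μ i * ν j * α i j + μ i * ν j * α i j)
      ≡⟨ ∑∑-distrib-+ (λ i j → μ i * ν j * α i j) (λ i j → μ i * ν j * α i j) ⟩
    ∑[ i < n ] ∑[ j < n ] (μ i * ν j * α i j) + ∑[ i < n ] ∑[ j < n ] (μ i * ν j * α i j)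
      ≡⟨ cong₂ _+_ diag (trans diag (sym (sum-nxt (λ i → μ i * ν i)))) ⟩
    ∑[ i < n ] (μ i * ν i) + ∑[ i < n ] (μ (nxt i) * ν (nxt i))
      ≡⟨ ∑-distrib-+ (λ i → μ i * ν i) _ ⟨
    ∑[ i < n ] (μ i * ν i + μ (nxt i) * ν (nxt i))
      ≡⟨ (sum-cong-≗ λ i → product (μ i) (μ (nxt i)) (ν i) (ν (nxt i))) ⟨
    ∑[ i < n ] (∂ μ i * ∂ ν i + (μ i * ν (nxt i) + μ (nxt i) * ν i))
      ≡⟨ ∑-distrib-+ (λ i → ∂ μ i * ∂ ν i) _ ⟩
    ∑[ i < n ] (∂ μ i * ∂ ν i) + ∑[ i < n ] (μ i * ν (nxt i) + μ (nxt i) * ν i)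
      ≡⟨ cong (λ x → ∑[ i < n ] (∂ μ i * ∂ ν i) + x) (∑-distrib-+ (λ i → μ i * ν (nxt i)) _) ⟩
    ∑[ i < n ] (∂ μ i * ∂ ν i) + (∑[ i < n ] (μ i * ν (nxt i)) + ∑[ i < n ] (μ (nxt i) * ν i)) ∎)
    where
    open ≡-Reasoning

    product : ∀ x x′ y y′ → (x - x′) * (y - y′) + (x * y′ + x′ * y) ≡ x * y + x′ * y′
    product = solve-∀

    factor : ∀ x y a b c → x * (y * a) + (x * y * b + x * y * c) ≡ x * y * (a + (b + c))
    factor = solve-∀

    double : ∀ x a → x * (a + a) ≡ x * a + x * a
    double = solve-∀

    termwise : ∀ i j → μ i * (ν j * cartan i j) + (μ i * ν j * α (nxt i) j + μ i * ν j * α (nxt j) i)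
             ≡ μ i * ν j * α i j + μ i * ν j * α i j
    termwise i j = trans (factor (μ i) (ν j) (cartan i j) (α (nxt i) j) (α (nxt j) i))
      (trans (cong (λ x → μ i * ν j * x) (cartan-split i j)) (double (μ i * ν j) (α i j)))

    diag : ∑[ i < n ] ∑[ j < n ] (μ i * ν j * α i j) ≡ ∑[ i < n ] (μ i * ν i)
    diag = sum-cong-≗ λ i → ∑-*-indicator (λ j → μ i * ν j) i

    cross₁ : ∑[ i < n ] ∑[ j < n ] (μ i * ν j * α (nxt i) j) ≡ ∑[ i < n ] (μ i * ν (nxt i))
    cross₁ = sum-cong-≗ λ i → ∑-*-indicator (λ j → μ i * ν j) (nxt i)

    cross₂ : ∑[ i < n ] ∑[ j < n ] (μ i * ν j * α (nxt j) i) ≡ ∑[ i < n ] (μ (nxt i) * ν i)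
    cross₂ = trans (∑-comm (λ i j → μ i * ν j * α (nxt j) i))
      (sum-cong-≗ λ j → ∑-*-indicator (λ i → μ i * ν j) (nxt j))

  form-sym : ∀ μ ν → ⟨ μ , ν ⟩ ≡ ⟨ ν , μ ⟩
  form-sym μ ν = trans (form≡∑∂∂ μ ν)
    (trans (sum-cong-≗ λ i → ℤ.*-comm (∂ μ i) (∂ ν i)) (sym (form≡∑∂∂ ν μ)))

  form-cong : ∀ μ μ′ ν ν′ → μ ≗ μ′ → ν ≗ ν′ → ⟨ μ , ν ⟩ ≡ ⟨ μ′ , ν′ ⟩
  form-cong μ μ′ ν ν′ p q = sum-cong-≗ λ i → sum-cong-≗ λ j →
    cong₂ (λ x y → x * (y * cartan i j)) (p i) (q j)

  form-+-* : ∀ a μ ν β → ⟨ (λ l → μ l + a * ν l) , β ⟩ ≡ ⟨ μ , β ⟩ + a * ⟨ ν , β ⟩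
  form-+-* a μ ν β = begin
    ⟨ (λ l → μ l + a * ν l) , β ⟩ ≡⟨ form≡∑∂∂ (λ l → μ l + a * ν l) β ⟩
    ∑[ i < n ] (∂ (λ l → μ l + a * ν l) i * ∂ β i)
      ≡⟨ (sum-cong-≗ λ i → expand a (μ i) (μ (nxt i)) (ν i) (ν (nxt i)) (∂ β i)) ⟩
    ∑[ i < n ] (∂ μ i * ∂ β i + a * (∂ ν i * ∂ β i))
      ≡⟨ ∑-distrib-+ (λ i → ∂ μ i * ∂ β i) _ ⟩
    ∑[ i < n ] (∂ μ i * ∂ β i) + ∑[ i < n ] (a * (∂ ν i * ∂ β i))
      ≡⟨ cong₂ _+_ (form≡∑∂∂ μ β) (trans (cong (a *_) (form≡∑∂∂ ν β)) (*-distribˡ-sum a (λ i → ∂ ν i * ∂ β i))) ⟨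
    ⟨ μ , β ⟩ + a * ⟨ ν , β ⟩ ∎
    where
    open ≡-Reasoning
    expand : ∀ a x x′ y y′ b → (x + a * y - (x′ + a * y′)) * b ≡ (x - x′) * b + a * ((y - y′) * b)
    expand = solve-∀

  form-s : ∀ γ μ β → ⟨ s γ μ , β ⟩ ≡ ⟨ μ , β ⟩ - ⟨ μ , γ ⟩ * ⟨ γ , β ⟩
  form-s γ μ β = begin
    ⟨ s γ μ , β ⟩                                 ≡⟨ form-cong (s γ μ) (λ l → μ l + (- ⟨ μ , γ ⟩) * γ l) β β (λ l → shape (μ l) ⟨ μ , γ ⟩ (γ l)) (λ _ → refl) ⟩
    ⟨ (λ l → μ l + (- ⟨ μ , γ ⟩) * γ l) , β ⟩     ≡⟨ form-+-* (- ⟨ μ , γ ⟩) μ γ β ⟩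
    ⟨ μ , β ⟩ + (- ⟨ μ , γ ⟩) * ⟨ γ , β ⟩         ≡⟨ shape ⟨ μ , β ⟩ ⟨ μ , γ ⟩ ⟨ γ , β ⟩ ⟨
    ⟨ μ , β ⟩ - ⟨ μ , γ ⟩ * ⟨ γ , β ⟩             ∎
    where
    open ≡-Reasoning
    shape : ∀ x a y → x - a * y ≡ x + (- a) * y
    shape = solve-∀

  Root : Q → Set
  Root γ = ⟨ γ , γ ⟩ ≡ + 2

  s-cong : ∀ γ γ′ μ μ′ → γ ≗ γ′ → μ ≗ μ′ → s γ μ ≗ s γ′ μ′
  s-cong γ γ′ μ μ′ p q l = cong₂ _-_ (q l) (cong₂ _*_ (form-cong μ μ′ γ γ′ q p) (p l))

  s-invol : ∀ γ → Root γ → ∀ μ → s γ (s γ μ) ≗ μ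
  s-invol γ r μ l = begin
    s γ μ l - ⟨ s γ μ , γ ⟩ * γ l
      ≡⟨ cong (λ x → s γ μ l - x * γ l) (trans (form-s γ μ γ) (cong (λ x → ⟨ μ , γ ⟩ - ⟨ μ , γ ⟩ * x) r)) ⟩
    s γ μ l - (⟨ μ , γ ⟩ - ⟨ μ , γ ⟩ * + 2) * γ l ≡⟨ cancel (μ l) ⟨ μ , γ ⟩ (γ l) ⟩
    μ l ∎
    where
    open ≡-Reasoning
    cancel : ∀ x a y → x - a * y - (a - a * + 2) * y ≡ x
    cancel = solve-∀

  s-self : ∀ γ → Root γ → s γ γ ≗ -_ ∘ γ
  s-self γ r l = trans (cong (λ x → γ l - x * γ l) r) (shape (γ l))
    where
    shape : ∀ x → x - + 2 * x ≡ - x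
    shape = solve-∀

  s-isometry : ∀ γ → Root γ → ∀ μ ν → ⟨ s γ μ , s γ ν ⟩ ≡ ⟨ μ , ν ⟩
  s-isometry γ r μ ν = begin
    ⟨ s γ μ , s γ ν ⟩ ≡⟨ form-s γ μ (s γ ν) ⟩
    ⟨ μ , s γ ν ⟩ - ⟨ μ , γ ⟩ * ⟨ γ , s γ ν ⟩
      ≡⟨ cong₂ (λ x y → x - ⟨ μ , γ ⟩ * y) (flip μ) (flip γ) ⟩
    (⟨ ν , μ ⟩ - ⟨ ν , γ ⟩ * ⟨ γ , μ ⟩) - ⟨ μ , γ ⟩ * (⟨ ν , γ ⟩ - ⟨ ν , γ ⟩ * ⟨ γ , γ ⟩)
      ≡⟨ cong₂ (λ x y → (⟨ ν , μ ⟩ - ⟨ ν , γ ⟩ * x) - ⟨ μ , γ ⟩ * (⟨ ν , γ ⟩ - ⟨ ν , γ ⟩ * y)) (form-sym γ μ) r ⟩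
    (⟨ ν , μ ⟩ - ⟨ ν , γ ⟩ * ⟨ μ , γ ⟩) - ⟨ μ , γ ⟩ * (⟨ ν , γ ⟩ - ⟨ ν , γ ⟩ * + 2)
      ≡⟨ cancel ⟨ ν , μ ⟩ ⟨ ν , γ ⟩ ⟨ μ , γ ⟩ ⟩
    ⟨ ν , μ ⟩ ≡⟨ form-sym ν μ ⟩
    ⟨ μ , ν ⟩ ∎
    where
    open ≡-Reasoning
    flip : ∀ β → ⟨ β , s γ ν ⟩ ≡ ⟨ ν , β ⟩ - ⟨ ν , γ ⟩ * ⟨ γ , β ⟩
    flip β = trans (form-sym β (s γ ν)) (form-s γ ν β)
    cancel : ∀ x a b → (x - a * b) - b * (a - a * + 2) ≡ x
    cancel = solve-∀

  α-Root : ∀ i → Root (α i)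
  α-Root i = begin
    ∑[ j < n ] ∑[ l < n ] (α i j * (α i l * cartan j l))
      ≡⟨ (sum-cong-≗ λ j → trans (sum-cong-≗ λ l → swap (α i j) (α i l) (cartan j l))
                                 (∑-*-indicator (λ l → cartan j l * α i j) i)) ⟩
    ∑[ j < n ] (cartan j i * α i j) ≡⟨ ∑-*-indicator (λ j → cartan j i) i ⟩
    cartan i i ≡⟨ cartan-diag i ⟩
    + 2 ∎
    where
    open ≡-Reasoning
    swap : ∀ x y z → x * (y * z) ≡ z * x * y
    swap = solve-∀

  ▷-++ : ∀ u v μ → (u ++ v) ▷ μ ≡ u ▷ (v ▷ μ)
  ▷-++ []      v μ = refl
  ▷-++ (i ∷ u) v μ = cong (s (α i)) (▷-++ u v μ)

  ▷-cong : ∀ w μ ν → μ ≗ ν → w ▷ μ ≗ w ▷ ν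
  ▷-cong w μ ν = Linear.f-cong (▷-linear w) {μ} {ν}

  ▷-isometry : ∀ w μ ν → ⟨ w ▷ μ , w ▷ ν ⟩ ≡ ⟨ μ , ν ⟩
  ▷-isometry []      μ ν = refl
  ▷-isometry (i ∷ w) μ ν = trans (s-isometry (α i) (α-Root i) (w ▷ μ) (w ▷ ν)) (▷-isometry w μ ν)

  ▷-Root : ∀ w γ → Root γ → Root (w ▷ γ)
  ▷-Root w γ r = trans (▷-isometry w γ γ) r

  ▷-neg : ∀ w μ → w ▷ (-_ ∘ μ) ≗ -_ ∘ (w ▷ μ)
  ▷-neg w μ l = begin
    (w ▷ (-_ ∘ μ)) l           ≡⟨ ▷-cong w (-_ ∘ μ) (λ l → -1ℤ * μ l) (λ l → sym (ℤ.-1*i≡-i (μ l))) l ⟩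
    (w ▷ (λ l → -1ℤ * μ l)) l  ≡⟨ Linear.f-* (▷-linear w) -1ℤ μ l ⟩
    -1ℤ * (w ▷ μ) l            ≡⟨ ℤ.-1*i≡-i _ ⟩
    - (w ▷ μ) l                ∎
    where open ≡-Reasoning

  ▷-reverse : ∀ w μ → reverse w ▷ (w ▷ μ) ≗ μ
  ▷-reverse []      μ l = refl
  ▷-reverse (i ∷ w) μ l rewrite unfold-reverse i w | ▷-++ (reverse w) (i ∷ []) (s (α i) (w ▷ μ)) =
    trans (▷-cong (reverse w) (s (α i) (s (α i) (w ▷ μ))) (w ▷ μ) (s-invol (α i) (α-Root i) (w ▷ μ)) l) (▷-reverse w μ l)

  reverse-▷ : ∀ w μ → w ▷ (reverse w ▷ μ) ≗ μ
  reverse-▷ []      μ l = refl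
  reverse-▷ (i ∷ w) μ l rewrite unfold-reverse i w | ▷-++ (reverse w) (i ∷ []) μ =
    trans (s-cong (α i) (α i) (w ▷ reverse w ▷ s (α i) μ) (s (α i) μ) (λ _ → refl) (reverse-▷ w (s (α i) μ)) l) (s-invol (α i) (α-Root i) μ l)

  -- The conjugation formula w s_γ = s_{wγ} w, which holds because `w` is linear and preserves the
  -- form.
  ▷-s : ∀ w γ μ → w ▷ s γ μ ≗ s (w ▷ γ) (w ▷ μ)
  ▷-s w γ μ l = begin
    (w ▷ s γ μ) l ≡⟨ ▷-cong w (s γ μ) (λ l → μ l + (- ⟨ μ , γ ⟩) * γ l) (λ l → shape (μ l) ⟨ μ , γ ⟩ (γ l)) l ⟩
    (w ▷ (λ l → μ l + (- ⟨ μ , γ ⟩) * γ l)) l ≡⟨ Linear.f-+ (▷-linear w) μ (λ l → (- ⟨ μ , γ ⟩) * γ l) l ⟩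
    (w ▷ μ) l + (w ▷ (λ l → (- ⟨ μ , γ ⟩) * γ l)) l ≡⟨ cong (λ x → (w ▷ μ) l + x) (Linear.f-* (▷-linear w) (- ⟨ μ , γ ⟩) γ l) ⟩
    (w ▷ μ) l + (- ⟨ μ , γ ⟩) * (w ▷ γ) l ≡⟨ shape ((w ▷ μ) l) ⟨ μ , γ ⟩ ((w ▷ γ) l) ⟨
    (w ▷ μ) l - ⟨ μ , γ ⟩ * (w ▷ γ) l ≡⟨ cong (λ a → (w ▷ μ) l - a * (w ▷ γ) l) (▷-isometry w μ γ) ⟨
    s (w ▷ γ) (w ▷ μ) l ∎
    where
    open ≡-Reasoning
    shape : ∀ x a y → x - a * y ≡ x + (- a) * y
    shape = solve-∀

-- Classification of the vectors of norm 2.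

square-nonneg : ∀ i → 0ℤ ℤ.≤ i * i
square-nonneg (+ zero)  = +≤+ z≤n
square-nonneg (+ suc _) = +≤+ z≤n
square-nonneg -[1+ _ ]  = +≤+ z≤n

square-zero : ∀ i → i * i ≡ 0ℤ → i ≡ 0ℤ
square-zero i eq = [ (λ p → p) , (λ p → p) ]′ (ℤ.i*j≡0⇒i≡0∨j≡0 i eq)

square≤2 : ∀ i → i * i ℤ.≤ + 2 → i ≡ 0ℤ ⊎ i ≡ 1ℤ ⊎ i ≡ -1ℤ
square≤2 (+ 0)             _ = inj₁ refl
square≤2 (+ 1)             _ = inj₂ (inj₁ refl)
square≤2 (+ suc (suc zero)) (+≤+ (s≤s (s≤s ())))
square≤2 (+ suc (suc (suc k))) (+≤+ (s≤s (s≤s ())))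
square≤2 -[1+ 0 ]          _ = inj₂ (inj₂ refl)
square≤2 -[1+ suc zero ] (+≤+ (s≤s (s≤s ())))
square≤2 -[1+ suc (suc k) ] (+≤+ (s≤s (s≤s ())))

nonneg-summandˡ : ∀ {i j} → 0ℤ ℤ.≤ j → i ℤ.≤ i + j
nonneg-summandˡ {i} {j} 0≤j = subst (ℤ._≤ i + j) (ℤ.+-identityʳ i) (ℤ.+-monoʳ-≤ i 0≤j)

nonneg-summandʳ : ∀ {i j} → 0ℤ ℤ.≤ i → j ℤ.≤ i + j
nonneg-summandʳ {i} {j} 0≤i = subst (ℤ._≤ i + j) (ℤ.+-identityˡ j) (ℤ.+-monoˡ-≤ j 0≤i)

nonneg-+-zero : ∀ {i j} → 0ℤ ℤ.≤ i → 0ℤ ℤ.≤ j → i + j ≡ 0ℤ → i ≡ 0ℤ × j ≡ 0ℤ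
nonneg-+-zero {i} {j} 0≤i 0≤j eq =
  ℤ.≤-antisym (subst (i ℤ.≤_) eq (nonneg-summandˡ 0≤j)) 0≤i ,
  ℤ.≤-antisym (subst (j ℤ.≤_) eq (nonneg-summandʳ 0≤i)) 0≤j

sum-nonneg : ∀ {n} (f : Fin n → ℤ) → (∀ i → 0ℤ ℤ.≤ f i) → 0ℤ ℤ.≤ sum f
sum-nonneg {zero}  f 0≤f = ℤ.≤-refl
sum-nonneg {suc n} f 0≤f = ℤ.+-mono-≤ (0≤f zero) (sum-nonneg (f ∘ suc) (0≤f ∘ suc))

-- The last term is the step back to 0 that closes the cycle when g₀ = 0.
energy : ∀ {m} → (Fin (suc m) → ℤ) → ℤ
energy {m} g =
  ∑[ i < m ] ((g (inject₁ i) - g (suc i)) * (g (inject₁ i) - g (suc i))) + g (fromℕ m) * g (fromℕ m)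

energy-suc : ∀ {m} (g : Fin (suc (suc m)) → ℤ) →
  energy g ≡ (g zero - g (suc zero)) * (g zero - g (suc zero)) + energy (g ∘ suc)
energy-suc g = ℤ.+-assoc ((g zero - g (suc zero)) * (g zero - g (suc zero))) _ _

energy-nonneg : ∀ {m} (g : Fin (suc m) → ℤ) → 0ℤ ℤ.≤ energy g
energy-nonneg {m} g = ℤ.+-mono-≤ (sum-nonneg {m} _ λ i → square-nonneg (g (inject₁ i) - g (suc i)))
  (square-nonneg (g (fromℕ m)))

energy-neg : ∀ {m} (g : Fin (suc m) → ℤ) → energy (-_ ∘ g) ≡ energy g
energy-neg {m} g = cong₂ _+_ (sum-cong-≗ λ i → shape₂ (g (inject₁ i)) (g (suc i))) (shape₁ (g (fromℕ m)))
  where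
  shape₁ : ∀ x → (- x) * (- x) ≡ x * x
  shape₁ = solve-∀
  shape₂ : ∀ x y → (- x - - y) * (- x - - y) ≡ (x - y) * (x - y)
  shape₂ = solve-∀

energy-cyclic : ∀ {m} (g : Fin (suc m) → ℤ) → g zero ≡ 0ℤ →
  ∑[ i < suc m ] ((g i - g (nxt i)) * (g i - g (nxt i))) ≡ energy g
energy-cyclic {m} g g₀ = trans (sum-init-last (λ i → (g i - g (nxt i)) * (g i - g (nxt i))))
  (cong₂ _+_ (sum-cong-≗ λ i → cong (λ j → (g (inject₁ i) - g j) * (g (inject₁ i) - g j)) (nxt-inject₁ i))
    (cong₂ _*_ last last))
  where
  last : g (fromℕ m) - g (nxt (fromℕ m)) ≡ g (fromℕ m)
  last = trans (cong (λ x → g (fromℕ m) - x) (trans (cong g (nxt-fromℕ m)) g₀)) (ℤ.+-identityʳ (g (fromℕ m)))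

-- The last square pins the right end to 0, and vanishing differences carry this value leftwards.
energy-zero : ∀ {m} (g : Fin (suc m) → ℤ) → energy g ≡ 0ℤ → ∀ k → g k ≡ 0ℤ
energy-zero {zero} g e zero = square-zero (g zero) (trans (sym (ℤ.+-identityˡ _)) e)
energy-zero {suc m} g e k with nonneg-+-zero (square-nonneg (g zero - g (suc zero))) (energy-nonneg (g ∘ suc))
                                (trans (sym (energy-suc g)) e)
energy-zero {suc m} g e zero    | d , e′ =
  trans (ℤ.i-j≡0⇒i≡j (g zero) (g (suc zero)) (square-zero (g zero - g (suc zero)) d)) (energy-zero (g ∘ suc) e′ zero)
energy-zero {suc m} g e (suc k) | d , e′ = energy-zero (g ∘ suc) e′ k

does-≤?-suc : ∀ a b → does (suc a ℕ.≤? suc b) ≡ does (a ℕ.≤? b)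
does-≤?-suc zero    b = refl
does-≤?-suc (suc a) b = refl

interval-suc : ∀ {m} (i j k : Fin m) → AffineA.interval (suc m) (suc i) (suc j) (suc k) ≡ AffineA.interval m i j k
interval-suc i j k = cong₂ (λ x y → if x ∧ y then 1ℤ else 0ℤ)
  (does-≤?-suc (toℕ i) (toℕ k)) (does-≤?-suc (toℕ k) (toℕ j))

-- A walk from 1 that must end at 0 needs a drop, and energy 1 pays for a single unit step: the
-- values are 1 up to some index `j` and 0 afterwards.
energy-one : ∀ {m} (g : Fin (suc m) → ℤ) → g zero ≡ 1ℤ → energy g ≡ 1ℤ →
  ∃ λ j → g ≗ AffineA.interval (suc m) zero j
energy-one {zero}  g g₀ e = zero , λ { zero → g₀ }
energy-one {suc m} g g₀ e = by-cases (square≤2 (g zero - g (suc zero)) bound)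
  where
  split : (g zero - g (suc zero)) * (g zero - g (suc zero)) + energy (g ∘ suc) ≡ 1ℤ
  split = trans (sym (energy-suc g)) e

  bound : (g zero - g (suc zero)) * (g zero - g (suc zero)) ℤ.≤ + 2
  bound = ℤ.≤-trans (subst ((g zero - g (suc zero)) * (g zero - g (suc zero)) ℤ.≤_) split (nonneg-summandˡ (energy-nonneg (g ∘ suc)))) (+≤+ (s≤s z≤n))

  rest : ∀ {t} → g zero - g (suc zero) ≡ t → t * t + energy (g ∘ suc) ≡ 1ℤ
  rest refl = split

  next : ∀ {t} → g zero - g (suc zero) ≡ t → g (suc zero) ≡ 1ℤ - t
  next refl = trans (shape (g zero) (g (suc zero))) (cong (λ x → x - (g zero - g (suc zero))) g₀)
    where
    shape : ∀ x y → y ≡ x - (x - y)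
    shape = solve-∀

  by-cases : g zero - g (suc zero) ≡ 0ℤ ⊎ g zero - g (suc zero) ≡ 1ℤ ⊎ g zero - g (suc zero) ≡ -1ℤ →
    ∃ λ j → g ≗ AffineA.interval (suc (suc m)) zero j
  by-cases (inj₁ t) with energy-one (g ∘ suc) (next t) (trans (sym (ℤ.+-identityˡ _)) (rest t))
  ... | j , eq = suc j , λ { zero → g₀ ; (suc k) → trans (eq k) (cong (if_then 1ℤ else 0ℤ) (sym (does-≤?-suc (toℕ k) (toℕ j)))) }
  by-cases (inj₂ (inj₁ t)) = zero , λ { zero → g₀ ; (suc k) → energy-zero (g ∘ suc) (∙-cancelˡ ℤ.+-0-abelianGroup 1ℤ _ 0ℤ (rest t)) k }
  -- A step up to 2 spends all the energy, yet the remaining walk of energy 0 would have to start at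
  -- 0.
  by-cases (inj₂ (inj₂ t)) with trans (sym (next t)) (energy-zero (g ∘ suc) (∙-cancelˡ ℤ.+-0-abelianGroup 1ℤ _ 0ℤ (rest t)) zero)
  ... | ()

-- The closed walk from 0 to 0 has energy for two unit steps, one away from 0 and one back, so it is
-- plus or minus the indicator of an interval. As long as it rests at 0 the recursion moves on;
-- after the first step `energy-one` describes the tail, up to sign.
energy-two : ∀ {m} (g : Fin (suc m) → ℤ) → g zero ≡ 0ℤ → energy g ≡ + 2 →
  ∃ λ i → ∃ λ j → 1 ℕ.≤ toℕ i × toℕ i ℕ.≤ toℕ j ×
    (g ≗ AffineA.interval (suc m) i j ⊎ -_ ∘ g ≗ AffineA.interval (suc m) i j)
energy-two {zero}  g g₀ e with trans (sym e) (cong (λ x → 0ℤ + x * x) g₀)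
... | ()
energy-two {suc m} g g₀ e = by-cases (square≤2 (g (suc zero)) bound)
  where
  split : g (suc zero) * g (suc zero) + energy (g ∘ suc) ≡ + 2
  split = trans (cong (_+ energy (g ∘ suc))
    (trans (shape (g (suc zero))) (cong (λ x → (x - g (suc zero)) * (x - g (suc zero))) (sym g₀))))
    (trans (sym (energy-suc g)) e)
    where
    shape : ∀ x → x * x ≡ (0ℤ - x) * (0ℤ - x)
    shape = solve-∀

  bound : g (suc zero) * g (suc zero) ℤ.≤ + 2
  bound = subst (g (suc zero) * g (suc zero) ℤ.≤_) split (nonneg-summandˡ (energy-nonneg (g ∘ suc)))

  rest : ∀ {t} → g (suc zero) ≡ t → t * t + energy (g ∘ suc) ≡ + 2
  rest refl = split

  by-cases : g (suc zero) ≡ 0ℤ ⊎ g (suc zero) ≡ 1ℤ ⊎ g (suc zero) ≡ -1ℤ →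
    ∃ λ i → ∃ λ j → 1 ℕ.≤ toℕ i × toℕ i ℕ.≤ toℕ j ×
      (g ≗ AffineA.interval (suc (suc m)) i j ⊎ -_ ∘ g ≗ AffineA.interval (suc (suc m)) i j)
  by-cases (inj₁ t) with energy-two (g ∘ suc) t (trans (sym (ℤ.+-identityˡ _)) (rest t))
  ... | i , j , 1≤i , i≤j , inj₁ eq = suc i , suc j , s≤s z≤n , s≤s i≤j ,
    inj₁ λ { zero → g₀ ; (suc k) → trans (eq k) (sym (interval-suc i j k)) }
  ... | i , j , 1≤i , i≤j , inj₂ eq = suc i , suc j , s≤s z≤n , s≤s i≤j ,
    inj₂ λ { zero → cong -_ g₀ ; (suc k) → trans (eq k) (sym (interval-suc i j k)) }
  by-cases (inj₂ (inj₁ t)) with energy-one (g ∘ suc) t (∙-cancelˡ ℤ.+-0-abelianGroup 1ℤ _ 1ℤ (rest t))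
  ... | j , eq = suc zero , suc j , s≤s z≤n , s≤s z≤n ,
    inj₁ λ { zero → g₀ ; (suc k) → trans (eq k) (sym (interval-suc zero j k)) }
  by-cases (inj₂ (inj₂ t)) with energy-one (-_ ∘ g ∘ suc) (cong -_ t)
                                  (trans (energy-neg (g ∘ suc)) (∙-cancelˡ ℤ.+-0-abelianGroup 1ℤ _ 1ℤ (rest t)))
  ... | j , eq = suc zero , suc j , s≤s z≤n , s≤s z≤n ,
    inj₂ λ { zero → cong -_ g₀ ; (suc k) → trans (eq k) (sym (interval-suc zero j k)) }

energy-cong : ∀ {m} (f g : Fin (suc m) → ℤ) → f ≗ g → energy f ≡ energy g
energy-cong {m} f g eq = cong₂ _+_
  (sum-cong-≗ λ i → cong₂ (λ x y → (x - y) * (x - y)) (eq (inject₁ i)) (eq (suc i)))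
  (cong (λ x → x * x) (eq (fromℕ m)))

energy-interval-zero : ∀ {m} (j : Fin (suc m)) → energy (AffineA.interval (suc m) zero j) ≡ 1ℤ
energy-interval-zero {zero}  zero = refl
energy-interval-zero {suc m} zero = cong (λ x → 1ℤ + x + 0ℤ) (sum-replicate-zero m)
energy-interval-zero {suc m} (suc j) = trans (energy-suc (AffineA.interval (suc (suc m)) zero (suc j)))
  (trans (ℤ.+-identityˡ _)
    (trans (energy-cong _ (AffineA.interval (suc m) zero j) (λ k → cong (if_then 1ℤ else 0ℤ) (does-≤?-suc (toℕ k) (toℕ j))))
           (energy-interval-zero j)))

energy-interval : ∀ {m} (i j : Fin (suc m)) → 1 ℕ.≤ toℕ i → toℕ i ℕ.≤ toℕ j →
  energy (AffineA.interval (suc m) i j) ≡ + 2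
energy-interval {suc m} (suc zero) (suc j) _ _ = trans (energy-suc (AffineA.interval (suc (suc m)) (suc zero) (suc j)))
  (cong (λ x → 1ℤ + x) (trans (energy-cong _ (AffineA.interval (suc m) zero j) (interval-suc zero j)) (energy-interval-zero j)))
energy-interval {suc m} (suc (suc i)) (suc j) _ (s≤s i≤j) = trans (energy-suc (AffineA.interval (suc (suc m)) (suc (suc i)) (suc j)))
  (trans (ℤ.+-identityˡ _)
    (trans (energy-cong _ (AffineA.interval (suc m) (suc i) j) (interval-suc (suc i) j)) (energy-interval (suc i) j (s≤s z≤n) i≤j)))

-- Only differences of neighbouring coordinates enter the form, so multiples of `c` lie in its
-- radical.
energy-norm : ∀ {m} (n≥3 : 3 ℕ.≤ suc m) (β γ : Fin (suc m) → ℤ) a → β zero ≡ 0ℤ →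
  (∀ k → γ k ≡ β k + a * 1ℤ) → AffineA.⟨_,_⟩ (suc m) γ γ ≡ energy β
energy-norm {m} n≥3 β γ a β₀ eq = trans (Form.form≡∑∂∂ (suc m) n≥3 γ γ)
  (trans (sum-cong-≗ {suc m} λ i → cong₂ _*_ (difference i) (difference i)) (energy-cyclic β β₀))
  where
  difference : ∀ i → γ i - γ (nxt i) ≡ β i - β (nxt i)
  difference i = trans (cong₂ _-_ (eq i) (eq (nxt i))) (cancel (β i) (β (nxt i)) a)
    where
    cancel : ∀ x y a → x + a * 1ℤ - (y + a * 1ℤ) ≡ x - y
    cancel = solve-∀

norm-two⇒real : ∀ n → 3 ℕ.≤ n → ∀ γ → AffineA.⟨_,_⟩ n γ γ ≡ + 2 →
  ∃ λ β → ∃ λ a → AffineA.Π n β × (∀ k → γ k ≡ β k + a * 1ℤ)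
norm-two⇒real (suc m) n≥3 γ r = finish (energy-two β β₀ (trans (sym (energy-norm n≥3 β γ (γ zero) β₀ eq)) r))
  where
  β : Fin (suc m) → ℤ
  -- Finite roots have α₀-coordinate 0 and `c` has α₀-coordinate 1, so the coefficient of `c` can
  -- only be `γ zero`.
  β k = γ k - γ zero

  β₀ : β zero ≡ 0ℤ
  β₀ = ℤ.+-inverseʳ (γ zero)

  eq : ∀ k → γ k ≡ β k + γ zero * 1ℤ
  eq k = shape (γ k) (γ zero)
    where
    shape : ∀ x y → x ≡ x - y + y * 1ℤ
    shape = solve-∀

  finish : (∃ λ i → ∃ λ j → 1 ℕ.≤ toℕ i × toℕ i ℕ.≤ toℕ j ×
      (β ≗ AffineA.interval (suc m) i j ⊎ -_ ∘ β ≗ AffineA.interval (suc m) i j)) →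
    ∃ λ β → ∃ λ a → AffineA.Π (suc m) β × (∀ k → γ k ≡ β k + a * 1ℤ)
  finish (i , j , 1≤i , i≤j , inj₁ p) = β , γ zero , inj₁ (i , j , 1≤i , i≤j , p) , eq
  finish (i , j , 1≤i , i≤j , inj₂ p) = β , γ zero , inj₂ (i , j , 1≤i , i≤j , p) , eq

real⇒norm-two : ∀ n → 3 ℕ.≤ n → ∀ β γ a → AffineA.Π n β → (∀ k → γ k ≡ β k + a * 1ℤ) →
  AffineA.⟨_,_⟩ n γ γ ≡ + 2
-- As `i` is a successor, `interval i j zero` computes to 0, and `p zero` gives the normalisation
-- `β zero ≡ 0ℤ`.
real⇒norm-two (suc m) n≥3 β γ a (inj₁ (i@(suc _) , j , 1≤i , i≤j , p)) eq =
  trans (energy-norm n≥3 β γ a (p zero) eq) (trans (energy-cong β _ p) (energy-interval i j 1≤i i≤j))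
real⇒norm-two (suc m) n≥3 β γ a (inj₂ (i@(suc _) , j , 1≤i , i≤j , p)) eq =
  trans (energy-norm n≥3 β γ a (trans (sym (ℤ.neg-involutive (β zero))) (cong -_ (p zero))) eq)
    (trans (sym (energy-neg β)) (trans (energy-cong (-_ ∘ β) _ p) (energy-interval i j 1≤i i≤j)))

coordinate≤sum : ∀ {n} (f : Fin n → ℤ) → (∀ i → 0ℤ ℤ.≤ f i) → ∀ i → f i ℤ.≤ sum f
coordinate≤sum f 0≤f zero    = nonneg-summandˡ (sum-nonneg (f ∘ suc) (0≤f ∘ suc))
coordinate≤sum f 0≤f (suc i) = ℤ.≤-trans (coordinate≤sum (f ∘ suc) (0≤f ∘ suc) i) (nonneg-summandʳ (0≤f zero))

-- Positive and negative real roots.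

module Roots (n : ℕ) (n≥3 : 3 ℕ.≤ n) where

  open AffineA n
  open Form n n≥3

  interval-bounds : ∀ i j k → 0ℤ ℤ.≤ interval i j k × interval i j k ℤ.≤ 1ℤ
  interval-bounds i j k with does (toℕ i ℕ.≤? toℕ k) ∧ does (toℕ k ℕ.≤? toℕ j)
  ... | true  = +≤+ z≤n , ℤ.≤-refl
  ... | false = ℤ.≤-refl , +≤+ z≤n

  Π-lower : ∀ β → Π β → ∀ k → -1ℤ ℤ.≤ β k
  Π-lower β (inj₁ (i , j , _ , _ , p)) k =
    subst (-1ℤ ℤ.≤_) (sym (p k)) (ℤ.≤-trans -≤+ (proj₁ (interval-bounds i j k)))
  Π-lower β (inj₂ (i , j , _ , _ , p)) k =
    subst (-1ℤ ℤ.≤_) (trans (cong -_ (sym (p k))) (ℤ.neg-involutive (β k))) (ℤ.neg-mono-≤ (proj₂ (interval-bounds i j k)))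

  Π-neg : ∀ β → Π β → Π (-_ ∘ β)
  Π-neg β (inj₁ (i , j , l , m , p)) = inj₂ (i , j , l , m , λ k → trans (ℤ.neg-involutive (β k)) (p k))
  Π-neg β (inj₂ p) = inj₁ p

  positive⇒Root : ∀ γ → PositiveRealRoot γ → Root γ
  positive⇒Root γ (β , a , Πβ , _ , eq) = real⇒norm-two n n≥3 β γ a Πβ eq

  -- A finite root has coordinates at least -1, and one copy of `c` already compensates for that.
  positive⇒nonneg : ∀ γ → PositiveRealRoot γ → ∀ k → 0ℤ ℤ.≤ γ k
  positive⇒nonneg γ (β , a , Πβ , inj₁ 0<a , eq) k = subst (0ℤ ℤ.≤_) (sym (eq k))
    (ℤ.+-mono-≤ (Π-lower β Πβ k) (subst (1ℤ ℤ.≤_) (sym (ℤ.*-identityʳ a)) (ℤ.i<j⇒suc[i]≤j 0<a)))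
  positive⇒nonneg γ (β , a , Πβ , inj₂ (refl , (i , j , _ , _ , p)) , eq) k = subst (0ℤ ℤ.≤_)
    (sym (trans (eq k) (trans (ℤ.+-identityʳ (β k)) (p k)))) (proj₁ (interval-bounds i j k))

  positive-cong : ∀ γ γ′ → γ ≗ γ′ → PositiveRealRoot γ → PositiveRealRoot γ′
  positive-cong γ γ′ p (β , a , Πβ , pos , eq) = β , a , Πβ , pos , λ k → trans (sym (p k)) (eq k)

  Root⇒positive⊎negative : ∀ γ → Root γ → PositiveRealRoot γ ⊎ PositiveRealRoot (-_ ∘ γ)
  Root⇒positive⊎negative γ r with norm-two⇒real n n≥3 γ r
  ... | β , a , Πβ , eq with ℤ.<-cmp 0ℤ a | Πβ
  ...   | tri< 0<a _ _ | _ = inj₁ (β , a , Πβ , inj₁ 0<a , eq)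
  ...   | tri≈ _ refl _ | inj₁ β⁺ = inj₁ (β , a , Πβ , inj₂ (refl , β⁺) , eq)
  ...   | tri≈ _ refl _ | inj₂ β⁻ = inj₂ (-_ ∘ β , 0ℤ , inj₁ β⁻ , inj₂ (refl , β⁻) ,
            λ k → trans (cong -_ (trans (eq k) (ℤ.+-identityʳ (β k)))) (sym (ℤ.+-identityʳ (- β k))))
  ...   | tri> _ _ a<0 | _ = inj₂ (-_ ∘ β , - a , Π-neg β Πβ , inj₁ (ℤ.neg-mono-< a<0) ,
            λ k → trans (cong -_ (eq k)) (shape (β k) a))
    where
    shape : ∀ x a → - (x + a * 1ℤ) ≡ - x + - a * 1ℤ
    shape = solve-∀

  Root⇒nonzero : ∀ γ → Root γ → ¬ (∀ k → γ k ≡ 0ℤ)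
  Root⇒nonzero γ r γ≡0 = contradiction
    (trans (sym r) (trans (form-cong γ (λ _ → 0ℤ) γ (λ _ → 0ℤ) γ≡0 γ≡0)
      (trans (form≡∑∂∂ (λ _ → 0ℤ) (λ _ → 0ℤ)) (sum-replicate-zero n)))) λ ()

  neg-nonneg⇒nonpos : ∀ {i} → 0ℤ ℤ.≤ - i → i ℤ.≤ 0ℤ
  neg-nonneg⇒nonpos {i} p = subst (ℤ._≤ 0ℤ) (ℤ.neg-involutive i) (ℤ.neg-mono-≤ p)

  positive⇒¬negative : ∀ γ → PositiveRealRoot γ → ¬ PositiveRealRoot (-_ ∘ γ)
  positive⇒¬negative γ p q = Root⇒nonzero γ (positive⇒Root γ p) λ k →
    ℤ.≤-antisym (neg-nonneg⇒nonpos (positive⇒nonneg (-_ ∘ γ) q k)) (positive⇒nonneg γ p k)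

  -- Converse of `positive⇒nonneg`: among vectors of norm 2 positivity is a sign condition on
  -- coordinates, which `positive?` can decide.
  nonneg-Root⇒positive : ∀ γ → Root γ → (∀ k → 0ℤ ℤ.≤ γ k) → PositiveRealRoot γ
  nonneg-Root⇒positive γ r 0≤γ with Root⇒positive⊎negative γ r
  ... | inj₁ p = p
  ... | inj₂ q = contradiction
    (λ k → ℤ.≤-antisym (neg-nonneg⇒nonpos (positive⇒nonneg (-_ ∘ γ) q k)) (0≤γ k)) (Root⇒nonzero γ r)

  α-nonneg : ∀ i k → 0ℤ ℤ.≤ α i k
  α-nonneg i k with does (i Fin.≟ k)
  ... | true  = +≤+ z≤n
  ... | false = ℤ.≤-refl

  α-positive : ∀ i → PositiveRealRoot (α i)
  α-positive i = nonneg-Root⇒positive (α i) (α-Root i) (α-nonneg i)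

  1≤sum-positive : ∀ γ → PositiveRealRoot γ → 1ℤ ℤ.≤ sum γ
  1≤sum-positive γ p = ℤ.i<j⇒suc[i]≤j (ℤ.≤∧≢⇒< (sum-nonneg γ (positive⇒nonneg γ p)) λ 0≡sum →
    Root⇒nonzero γ (positive⇒Root γ p) λ k → ℤ.≤-antisym
      (subst (γ k ℤ.≤_) (sym 0≡sum) (coordinate≤sum γ (positive⇒nonneg γ p) k)) (positive⇒nonneg γ p k))

  sα-off : ∀ i γ k → i ≢ k → s (α i) γ k ≡ γ k
  sα-off i γ k i≢k = trans (cong (λ x → γ k - ⟨ γ , α i ⟩ * x) (α-off i≢k)) (shape (γ k) ⟨ γ , α i ⟩)
    where
    shape : ∀ x a → x - a * 0ℤ ≡ x
    shape = solve-∀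

  double-square≡2 : ∀ a → 0ℤ ℤ.≤ a → a * a * + 2 ≡ + 2 → a ≡ 1ℤ
  double-square≡2 (+ 1)             _ _ = refl
  double-square≡2 (+ suc (suc zero))     _ ()
  double-square≡2 (+ suc (suc (suc k)))     _ ()

  supported⇒multiple : ∀ i (γ : Q) → (∀ k → i ≢ k → γ k ≡ 0ℤ) → ∀ k → γ k ≡ 0ℤ + γ i * α i k
  supported⇒multiple i γ vanish k = trans (by-cases (i Fin.≟ k)) (sym (ℤ.+-identityˡ (γ i * α i k)))
    where
    by-cases : Dec (i ≡ k) → γ k ≡ γ i * α i k
    by-cases (yes refl) = sym (trans (cong (λ x → γ i * x) (α-diag i)) (ℤ.*-identityʳ (γ i)))
    by-cases (no i≢k)   = trans (vanish k i≢k) (sym (trans (cong (λ x → γ i * x) (α-off i≢k)) (ℤ.*-zeroʳ (γ i))))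

  form-zero : ∀ β → ⟨ (λ _ → 0ℤ) , β ⟩ ≡ 0ℤ
  form-zero β = trans (form≡∑∂∂ (λ _ → 0ℤ) β) (sum-replicate-zero n)

  supported⇒form : ∀ i (γ : Q) → (∀ k → i ≢ k → γ k ≡ 0ℤ) → ∀ β → ⟨ γ , β ⟩ ≡ γ i * ⟨ α i , β ⟩
  supported⇒form i γ vanish β = begin
    ⟨ γ , β ⟩
      ≡⟨ form-cong γ (λ l → 0ℤ + γ i * α i l) β β (supported⇒multiple i γ vanish) (λ _ → refl) ⟩
    ⟨ (λ l → 0ℤ + γ i * α i l) , β ⟩           ≡⟨ form-+-* (γ i) (λ _ → 0ℤ) (α i) β ⟩
    ⟨ (λ _ → 0ℤ) , β ⟩ + γ i * ⟨ α i , β ⟩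
      ≡⟨ cong (λ x → x + γ i * ⟨ α i , β ⟩) (form-zero β) ⟩
    0ℤ + γ i * ⟨ α i , β ⟩                     ≡⟨ ℤ.+-identityˡ (γ i * ⟨ α i , β ⟩) ⟩
    γ i * ⟨ α i , β ⟩                          ∎
    where open ≡-Reasoning

  -- Such a γ equals a αᵢ and has norm 2a², so a is 1 or -1, and positivity selects 1.
  supported-positive : ∀ i γ → PositiveRealRoot γ → (∀ k → i ≢ k → γ k ≡ 0ℤ) → γ ≗ α i
  supported-positive i γ p vanish k = trans (supported⇒multiple i γ vanish k)
    (trans (cong (λ x → 0ℤ + x * α i k) γᵢ≡1) (trans (ℤ.+-identityˡ (1ℤ * α i k)) (ℤ.*-identityˡ (α i k))))
    where
    open ≡-Reasoning
    γᵢ≡1 : γ i ≡ 1ℤ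
    γᵢ≡1 = double-square≡2 (γ i) (positive⇒nonneg γ p i) (begin
      γ i * γ i * + 2               ≡⟨ ℤ.*-assoc (γ i) (γ i) (+ 2) ⟩
      γ i * (γ i * + 2)             ≡⟨ cong (λ x → γ i * (γ i * x)) (α-Root i) ⟨
      γ i * (γ i * ⟨ α i , α i ⟩)   ≡⟨ cong (λ x → γ i * x) (supported⇒form i γ vanish (α i)) ⟨
      γ i * ⟨ γ , α i ⟩             ≡⟨ cong (λ x → γ i * x) (form-sym γ (α i)) ⟩
      γ i * ⟨ α i , γ ⟩             ≡⟨ supported⇒form i γ vanish γ ⟨
      ⟨ γ , γ ⟩                     ≡⟨ positive⇒Root γ p ⟩
      + 2                           ∎)

  -- Apart from its i-th coordinate sᵢ γ agrees with γ, so if it is negative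
  -- then γ is a multiple of αᵢ.
  sα-positive : ∀ i γ → PositiveRealRoot γ → γ ≗ α i ⊎ PositiveRealRoot (s (α i) γ)
  sα-positive i γ p = by-cases (Root⇒positive⊎negative (s (α i) γ)
                           (trans (s-isometry (α i) (α-Root i) γ γ) (positive⇒Root γ p)))
    where
    by-cases : PositiveRealRoot (s (α i) γ) ⊎ PositiveRealRoot (-_ ∘ s (α i) γ) →
      γ ≗ α i ⊎ PositiveRealRoot (s (α i) γ)
    by-cases (inj₁ q) = inj₂ q
    by-cases (inj₂ q) = inj₁ (supported-positive i γ p λ k i≢k → ℤ.≤-antisym
      (subst (ℤ._≤ 0ℤ) (sα-off i γ k i≢k) (neg-nonneg⇒nonpos (positive⇒nonneg (-_ ∘ s (α i) γ) q k)))
      (positive⇒nonneg γ p k))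

-- Strong exchange, and the length along an edge.

module Exchange (n : ℕ) (n≥3 : 3 ℕ.≤ n) where

  open AffineA n
  open Form n n≥3
  open Roots n n≥3

  ≈-refl : ∀ u → u ≈ u
  ≈-refl u μ k = refl

  ≈-sym : ∀ u v → u ≈ v → v ≈ u
  ≈-sym u v p μ k = sym (p μ k)

  ≈-trans : ∀ u v w → u ≈ v → v ≈ w → u ≈ w
  ≈-trans u v w p q μ k = trans (p μ k) (q μ k)

  ++-congˡ : ∀ u u′ v → u ≈ u′ → u ++ v ≈ u′ ++ v
  ++-congˡ u u′ v p μ k rewrite ▷-++ u v μ | ▷-++ u′ v μ = p (v ▷ μ) k

  ++-congʳ : ∀ u v v′ → v ≈ v′ → u ++ v ≈ u ++ v′
  ++-congʳ u v v′ p μ k rewrite ▷-++ u v μ | ▷-++ u v′ μ = ▷-cong u (v ▷ μ) (v′ ▷ μ) (p μ) k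

  ∷ʳ-involutive : ∀ u i → (u ∷ʳ i) ∷ʳ i ≈ u
  ∷ʳ-involutive u i μ k rewrite ▷-++ (u ∷ʳ i) (i ∷ []) μ | ▷-++ u (i ∷ []) (s (α i) μ) =
    ▷-cong u (s (α i) (s (α i) μ)) μ (s-invol (α i) (α-Root i) μ) k

  negative-step : ∀ i γ → PositiveRealRoot γ → PositiveRealRoot (-_ ∘ s (α i) γ) → γ ≗ α i
  negative-step i γ p q = [ (λ eq → eq) , (λ r → contradiction q (positive⇒¬negative (s (α i) γ) r)) ]′
    (sα-positive i γ p)

  Deletion : W → Q → Set
  Deletion w γ = ∃ λ u → ∃ λ i → ∃ λ v → w ≡ u ++ i ∷ v × (∀ μ → (u ++ v) ▷ μ ≗ w ▷ s γ μ)

  -- If wγ = αᵢ, then sᵢ w s_γ = sᵢ s_{wγ} w = w, so the leading letter disappears.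
  Deletion-here : ∀ i w γ → Root γ → w ▷ γ ≗ α i → Deletion (i ∷ w) γ
  Deletion-here i w γ r eq = [] , i , w , refl , λ μ k → sym (trans
    (s-cong (α i) (w ▷ γ) (w ▷ s γ μ) (s (w ▷ γ) (w ▷ μ)) (λ l → sym (eq l)) (▷-s w γ μ) k)
    (s-invol (w ▷ γ) (▷-Root w γ r) (w ▷ μ) k))

  Deletion-there : ∀ i w γ → Deletion w γ → Deletion (i ∷ w) γ
  Deletion-there i w γ (u , j , v , refl , eq) = i ∷ u , j , v , refl , λ μ k →
    s-cong (α i) (α i) ((u ++ v) ▷ μ) (w ▷ s γ μ) (λ _ → refl) (eq μ) k

  -- The strong exchange condition, for words that need not be reduced. The letters act on γ from
  -- the right end of the word; where the sign turns, a letter `i` makes a positive root negative,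
  -- so that root is αᵢ and this letter can be deleted.
  exchange : ∀ w γ → PositiveRealRoot γ → PositiveRealRoot (-_ ∘ (w ▷ γ)) → Deletion w γ
  exchange []      γ p q = contradiction q (positive⇒¬negative γ p)
  exchange (i ∷ w) γ p q = [
      (λ r → Deletion-here i w γ (positive⇒Root γ p) (negative-step i (w ▷ γ) r q))
    , (λ r → Deletion-there i w γ (exchange w γ p r))
    ]′ (Root⇒positive⊎negative (w ▷ γ) (▷-Root w γ (positive⇒Root γ p)))

  ℓ≤length : ∀ u q → q ≈ u → ℓ u ℕ.≤ length q
  ℓ≤length u q = proj₂ (proj₂ (reduce u)) q

  reduced≈ : ∀ u → reduced u ≈ u
  reduced≈ u = proj₁ (proj₂ (reduce u))

  ℓ-cong : ∀ u v → u ≈ v → ℓ u ≡ ℓ v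
  ℓ-cong u v p = ℕ.≤-antisym
    (ℓ≤length u (reduced v) (≈-trans (reduced v) v u (reduced≈ v) (≈-sym u v p)))
    (ℓ≤length v (reduced u) (≈-trans (reduced u) u v (reduced≈ u) p))

  length-delete : ∀ {A : Set} (u : List A) i v → length (u ++ v) ℕ.< length (u ++ i ∷ v)
  length-delete []      i v = ℕ.≤-refl
  length-delete (_ ∷ u) i v = s≤s (length-delete u i v)

  Edge-s : ∀ u γ v → Edge u γ v → ∀ μ → u ▷ μ ≗ v ▷ s γ μ
  Edge-s u γ v (p , eq) μ k = sym (trans (eq (s γ μ) k)
    (▷-cong u (s γ (s γ μ)) μ (s-invol γ (positive⇒Root γ p) μ) k))

  Edge-sym : ∀ u γ v → Edge u γ v → Edge v γ u
  Edge-sym u γ v e@(p , eq) = p , Edge-s u γ v e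

  Edge-root : ∀ u γ v → Edge u γ v → v ▷ γ ≗ -_ ∘ (u ▷ γ)
  Edge-root u γ v (p , eq) k = trans (eq γ k)
    (trans (▷-cong u (s γ γ) (-_ ∘ γ) (s-self γ (positive⇒Root γ p)) k) (▷-neg u γ k))

  Deletion⇒ℓ< : ∀ w γ u v → w ≈ u → (∀ μ → v ▷ μ ≗ u ▷ s γ μ) → Deletion w γ → ℓ v ℕ.< length w
  Deletion⇒ℓ< w γ u v w≈u eq (x , i , y , refl , eq′) = ℕ.≤-<-trans
    (ℓ≤length v (x ++ y) λ μ k → trans (eq′ μ k) (trans (w≈u (s γ μ) k) (sym (eq μ k))))
    (length-delete x i y)

  -- `exchange` deletes a letter from a shortest word for `u`, leaving a word for `v`.
  Edge-descent : ∀ u γ v → Edge u γ v → PositiveRealRoot (-_ ∘ (u ▷ γ)) → ℓ v ℕ.< ℓ u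
  Edge-descent u γ v (p , eq) q = Deletion⇒ℓ< (reduced u) γ u v (reduced≈ u) eq
    (exchange (reduced u) γ p
      (positive-cong (-_ ∘ (u ▷ γ)) (-_ ∘ (reduced u ▷ γ)) (λ k → cong -_ (sym (reduced≈ u γ k))) q))

  -- By `Edge-root` the other end sends γ to the opposite root, so the reversed edge is a descent.
  Edge-ascent : ∀ u γ v → Edge u γ v → PositiveRealRoot (u ▷ γ) → ℓ u ℕ.< ℓ v
  Edge-ascent u γ v e q = Edge-descent v γ u (Edge-sym u γ v e)
    (positive-cong (u ▷ γ) (-_ ∘ (v ▷ γ))
      (λ k → trans (sym (ℤ.neg-involutive ((u ▷ γ) k))) (cong -_ (sym (Edge-root u γ v e k)))) q)

  Edge-sign : ∀ u γ v → Edge u γ v → PositiveRealRoot (u ▷ γ) ⊎ PositiveRealRoot (-_ ∘ (u ▷ γ))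
  Edge-sign u γ v (p , _) = Root⇒positive⊎negative (u ▷ γ) (▷-Root u γ (positive⇒Root γ p))

  Edge-descent⁻¹ : ∀ u γ v → Edge u γ v → ℓ v ℕ.< ℓ u → PositiveRealRoot (-_ ∘ (u ▷ γ))
  Edge-descent⁻¹ u γ v e v<u =
    [ (λ q → contradiction v<u (ℕ.<-asym (Edge-ascent u γ v e q))) , (λ q → q) ]′ (Edge-sign u γ v e)

  Edge-ascent⁻¹ : ∀ u γ v → Edge u γ v → ℓ u ℕ.< ℓ v → PositiveRealRoot (u ▷ γ)
  Edge-ascent⁻¹ u γ v e u<v =
    [ (λ q → q) , (λ q → contradiction u<v (ℕ.<-asym (Edge-descent u γ v e q))) ]′ (Edge-sign u γ v e)

  Edge-∷ʳ : ∀ u i → Edge u (α i) (u ∷ʳ i)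
  Edge-∷ʳ u i = α-positive i , λ μ k → cong (λ f → f k) (▷-++ u (i ∷ []) μ)

  →ᴮ-∷ʳ : ∀ u i → u →ᴮ u ∷ʳ i ⊎ u ∷ʳ i →ᴮ u
  →ᴮ-∷ʳ u i = [
      (λ p → inj₁ ((α i , Edge-∷ʳ u i) , Edge-ascent u (α i) (u ∷ʳ i) (Edge-∷ʳ u i) p))
    , (λ p → inj₂ ((α i , Edge-sym u (α i) (u ∷ʳ i) (Edge-∷ʳ u i)) ,
                   Edge-descent u (α i) (u ∷ʳ i) (Edge-∷ʳ u i) p))
    ]′ (Edge-sign u (α i) (u ∷ʳ i) (Edge-∷ʳ u i))

  ∷ʳ-▷ : ∀ u i μ → (u ∷ʳ i) ▷ μ ≡ u ▷ s (α i) μ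
  ∷ʳ-▷ u i μ = ▷-++ u (i ∷ []) μ

  ∷ʳ-▷-s : ∀ u i γ → (u ∷ʳ i) ▷ s (α i) γ ≗ u ▷ γ
  ∷ʳ-▷-s u i γ k = trans (cong (λ f → f k) (∷ʳ-▷ u i (s (α i) γ)))
    (▷-cong u (s (α i) (s (α i) γ)) γ (s-invol (α i) (α-Root i) γ) k)

  -- s_γ sᵢ = sᵢ s_{sᵢ γ}
  Edge-∷ʳ-mono : ∀ u γ v i → Edge u γ v → PositiveRealRoot (s (α i) γ) → Edge (u ∷ʳ i) (s (α i) γ) (v ∷ʳ i)
  Edge-∷ʳ-mono u γ v i (p , eq) q = q , λ μ k → begin
    ((v ∷ʳ i) ▷ μ) k                         ≡⟨ cong (λ f → f k) (∷ʳ-▷ v i μ) ⟩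
    (v ▷ s (α i) μ) k                        ≡⟨ eq (s (α i) μ) k ⟩
    (u ▷ s γ (s (α i) μ)) k                  ≡⟨ ▷-cong u (s γ (s (α i) μ)) (s (α i) (s (s (α i) γ) μ)) (commute μ) k ⟩
    (u ▷ s (α i) (s (s (α i) γ) μ)) k        ≡⟨ cong (λ f → f k) (∷ʳ-▷ u i (s (s (α i) γ) μ)) ⟨
    ((u ∷ʳ i) ▷ s (s (α i) γ) μ) k           ∎
    where
    open ≡-Reasoning
    commute : ∀ μ → s γ (s (α i) μ) ≗ s (α i) (s (s (α i) γ) μ)
    commute μ k = sym (trans (▷-s (i ∷ []) (s (α i) γ) μ k)
      (s-cong (s (α i) (s (α i) γ)) γ (s (α i) μ) (s (α i) μ) (s-invol (α i) (α-Root i) γ) (λ _ → refl) k))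

  -- The source of the lifting property. Unless γ = αᵢ, right multiplication by sᵢ turns the edge
  -- into one of root sᵢγ; since (u sᵢ)(sᵢγ) = uγ, the sign that decides the direction is unchanged.
  →ᴮ-∷ʳ-mono : ∀ u v i → u →ᴮ v → u ∷ʳ i ≈ v ⊎ u ∷ʳ i →ᴮ v ∷ʳ i
  →ᴮ-∷ʳ-mono u v i ((γ , e@(p , eq)) , u<v) = [ (λ q → inj₁ (simple q)) , (λ q → inj₂ (other q)) ]′ (sα-positive i γ p)
    where
    simple : γ ≗ α i → u ∷ʳ i ≈ v
    simple γ≗α μ k = trans (cong (λ f → f k) (∷ʳ-▷ u i μ))
      (trans (▷-cong u (s (α i) μ) (s γ μ) (s-cong (α i) γ μ μ (λ l → sym (γ≗α l)) (λ _ → refl)) k) (sym (eq μ k)))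

    other : PositiveRealRoot (s (α i) γ) → u ∷ʳ i →ᴮ v ∷ʳ i
    other q = (s (α i) γ , e′) , Edge-ascent (u ∷ʳ i) (s (α i) γ) (v ∷ʳ i) e′
      (positive-cong (u ▷ γ) ((u ∷ʳ i) ▷ s (α i) γ) (λ k → sym (∷ʳ-▷-s u i γ k)) (Edge-ascent⁻¹ u γ v e u<v))
      where
      e′ : Edge (u ∷ʳ i) (s (α i) γ) (v ∷ʳ i)
      e′ = Edge-∷ʳ-mono u γ v i e q

-- Bruhat order and Hecke product.

module Bruhat (n : ℕ) (n≥3 : 3 ℕ.≤ n) where

  open AffineA n
  open Form n n≥3
  open Roots n n≥3
  open Exchange n n≥3

  ≈⇒≤ᴮ : ∀ u v → u ≈ v → u ≤ᴮ v
  ≈⇒≤ᴮ u v p = inj₁ p ◅ ε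

  →ᴮ⇒≤ᴮ : ∀ u v → u →ᴮ v → u ≤ᴮ v
  →ᴮ⇒≤ᴮ u v p = inj₂ p ◅ ε

  ≤ᴮ⇒≈⊎ℓ< : ∀ {u v} → u ≤ᴮ v → u ≈ v ⊎ ℓ u ℕ.< ℓ v
  ≤ᴮ⇒≈⊎ℓ< {u} ε = inj₁ (≈-refl u)
  ≤ᴮ⇒≈⊎ℓ< {u} {w} (_◅_ {j = v} (inj₁ p) q) =
    [ (λ v≈w → inj₁ (≈-trans u v w p v≈w))
    , (λ v<w → inj₂ (subst (ℕ._< ℓ w) (sym (ℓ-cong u v p)) v<w)) ]′ (≤ᴮ⇒≈⊎ℓ< q)
  ≤ᴮ⇒≈⊎ℓ< {u} {w} (_◅_ {j = v} (inj₂ (_ , u<v)) q) =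
    [ (λ v≈w → inj₂ (subst (ℓ u ℕ.<_) (ℓ-cong v w v≈w) u<v))
    , (λ v<w → inj₂ (ℕ.<-trans u<v v<w)) ]′ (≤ᴮ⇒≈⊎ℓ< q)

  ≤ᴮ-antisym : ∀ {u v} → u ≤ᴮ v → v ≤ᴮ u → u ≈ v
  ≤ᴮ-antisym {u} {v} p q =
    [ (λ u≈v → u≈v)
    , (λ u<v → [ (λ v≈u → ≈-sym v u v≈u) , (λ v<u → contradiction v<u (ℕ.<-asym u<v)) ]′ (≤ᴮ⇒≈⊎ℓ< q))
    ]′ (≤ᴮ⇒≈⊎ℓ< p)

  ≤ᴮ-id : ∀ u → u ≤ᴮ id → u ≈ id
  ≤ᴮ-id u p = [ (λ u≈id → u≈id) ,
    (λ u<id → contradiction (ℕ.<-≤-trans u<id (ℓ≤length id [] (≈-refl id))) λ ()) ]′ (≤ᴮ⇒≈⊎ℓ< p)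

  ·ₛ-up : ∀ u i → ℓ u ℕ.< ℓ (u ∷ʳ i) → u ·ₛ i ≡ u ∷ʳ i
  ·ₛ-up u i p = cong (if_then u ∷ʳ i else u) (dec-true (ℓ u ℕ.<? ℓ (u ∷ʳ i)) p)

  ·ₛ-down : ∀ u i → ¬ ℓ u ℕ.< ℓ (u ∷ʳ i) → u ·ₛ i ≡ u
  ·ₛ-down u i p = cong (if_then u ∷ʳ i else u) (dec-false (ℓ u ℕ.<? ℓ (u ∷ʳ i)) p)

  ·ₛ-spec : ∀ u i → (u →ᴮ u ∷ʳ i × u ·ₛ i ≡ u ∷ʳ i) ⊎ (u ∷ʳ i →ᴮ u × u ·ₛ i ≡ u)
  ·ₛ-spec u i = [ (λ p → inj₁ (p , ·ₛ-up u i (proj₂ p)))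
                , (λ p → inj₂ (p , ·ₛ-down u i (ℕ.<-asym (proj₂ p)))) ]′ (→ᴮ-∷ʳ u i)

  ≤-·ₛ : ∀ u i → u ≤ᴮ u ·ₛ i
  ≤-·ₛ u i = [ (λ { (p , eq) → subst (u ≤ᴮ_) (sym eq) (→ᴮ⇒≤ᴮ u (u ∷ʳ i) p) })
             , (λ { (_ , eq) → subst (u ≤ᴮ_) (sym eq) ε }) ]′ (·ₛ-spec u i)

  ∷ʳ≤-·ₛ : ∀ u i → u ∷ʳ i ≤ᴮ u ·ₛ i
  ∷ʳ≤-·ₛ u i = [ (λ { (_ , eq) → subst (u ∷ʳ i ≤ᴮ_) (sym eq) ε })
               , (λ { (p , eq) → subst (u ∷ʳ i ≤ᴮ_) (sym eq) (→ᴮ⇒≤ᴮ (u ∷ʳ i) u p) }) ]′ (·ₛ-spec u i)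

  ·ₛ-lub : ∀ u i x → u ≤ᴮ x → u ∷ʳ i ≤ᴮ x → u ·ₛ i ≤ᴮ x
  ·ₛ-lub u i x p q = [ (λ { (_ , eq) → subst (_≤ᴮ x) (sym eq) q })
                     , (λ { (_ , eq) → subst (_≤ᴮ x) (sym eq) p }) ]′ (·ₛ-spec u i)

  ∷ʳ-≈ : ∀ u v i → u ≈ v → u ∷ʳ i ≤ᴮ v ∷ʳ i
  ∷ʳ-≈ u v i p = ≈⇒≤ᴮ (u ∷ʳ i) (v ∷ʳ i) (++-congˡ u v (i ∷ []) p)

  -- As `u ·ₛ i` is one of `u` and `u ∷ʳ i`, it is enough to bound both by `v ·ₛ i`; either outcome
  -- of `→ᴮ-∷ʳ-mono` does so, because `v ·ₛ i` lies above both `v` and `v ∷ʳ i`.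
  ·ₛ-mono : ∀ {u v} i → u ≤ᴮ v → u ·ₛ i ≤ᴮ v ·ₛ i
  ·ₛ-mono i ε = ε
  ·ₛ-mono {u} i (_◅_ {j = v} (inj₁ p) q) =
    ·ₛ-lub u i (v ·ₛ i) (inj₁ p ◅ ≤-·ₛ v i) (∷ʳ-≈ u v i p ◅◅ ∷ʳ≤-·ₛ v i) ◅◅ ·ₛ-mono i q
  ·ₛ-mono {u} i (_◅_ {j = v} (inj₂ p) q) =
    ·ₛ-lub u i (v ·ₛ i) (inj₂ p ◅ ≤-·ₛ v i)
      ([ (λ us≈v → inj₁ us≈v ◅ ≤-·ₛ v i) , (λ us→vs → inj₂ us→vs ◅ ∷ʳ≤-·ₛ v i) ]′ (→ᴮ-∷ʳ-mono u v i p))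
    ◅◅ ·ₛ-mono i q

  infixl 7 _↓_
  -- The smaller of `u` and `u ∷ʳ i`, dual to `_·ₛ_`; for fixed `i` it is the left adjoint of
  -- `_·ₛ i` in the Bruhat order.
  _↓_ : W → Fin n → W
  u ↓ i = if does (ℓ (u ∷ʳ i) ℕ.<? ℓ u) then u ∷ʳ i else u

  ↓-up : ∀ u i → ¬ ℓ (u ∷ʳ i) ℕ.< ℓ u → u ↓ i ≡ u
  ↓-up u i p = cong (if_then u ∷ʳ i else u) (dec-false (ℓ (u ∷ʳ i) ℕ.<? ℓ u) p)

  ↓-down : ∀ u i → ℓ (u ∷ʳ i) ℕ.< ℓ u → u ↓ i ≡ u ∷ʳ i
  ↓-down u i p = cong (if_then u ∷ʳ i else u) (dec-true (ℓ (u ∷ʳ i) ℕ.<? ℓ u) p)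

  ↓-spec : ∀ u i → (u →ᴮ u ∷ʳ i × u ↓ i ≡ u) ⊎ (u ∷ʳ i →ᴮ u × u ↓ i ≡ u ∷ʳ i)
  ↓-spec u i = [ (λ p → inj₁ (p , ↓-up u i (ℕ.<-asym (proj₂ p))))
               , (λ p → inj₂ (p , ↓-down u i (proj₂ p))) ]′ (→ᴮ-∷ʳ u i)

  ↓-≤ : ∀ u i → u ↓ i ≤ᴮ u
  ↓-≤ u i = [ (λ { (_ , eq) → subst (_≤ᴮ u) (sym eq) ε })
            , (λ { (p , eq) → subst (_≤ᴮ u) (sym eq) (→ᴮ⇒≤ᴮ (u ∷ʳ i) u p) }) ]′ (↓-spec u i)

  ↓-≤∷ʳ : ∀ u i → u ↓ i ≤ᴮ u ∷ʳ i
  ↓-≤∷ʳ u i = [ (λ { (p , eq) → subst (_≤ᴮ u ∷ʳ i) (sym eq) (→ᴮ⇒≤ᴮ u (u ∷ʳ i) p) })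
              , (λ { (_ , eq) → subst (_≤ᴮ u ∷ʳ i) (sym eq) ε }) ]′ (↓-spec u i)

  ↓-glb : ∀ u i x → x ≤ᴮ u → x ≤ᴮ u ∷ʳ i → x ≤ᴮ u ↓ i
  ↓-glb u i x p q = [ (λ { (_ , eq) → subst (x ≤ᴮ_) (sym eq) p })
                    , (λ { (_ , eq) → subst (x ≤ᴮ_) (sym eq) q }) ]′ (↓-spec u i)

  ∷ʳ-swap : ∀ u v i → u ∷ʳ i ≈ v → u ≈ v ∷ʳ i
  ∷ʳ-swap u v i p = ≈-trans u ((u ∷ʳ i) ∷ʳ i) (v ∷ʳ i)
    (≈-sym ((u ∷ʳ i) ∷ʳ i) u (∷ʳ-involutive u i)) (++-congˡ (u ∷ʳ i) v (i ∷ []) p)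

  ↓-mono : ∀ {u v} i → u ≤ᴮ v → u ↓ i ≤ᴮ v ↓ i
  ↓-mono i ε = ε
  ↓-mono {u} i (_◅_ {j = v} (inj₁ p) q) =
    ↓-glb v i (u ↓ i) (↓-≤ u i ◅◅ ≈⇒≤ᴮ u v p) (↓-≤∷ʳ u i ◅◅ ∷ʳ-≈ u v i p) ◅◅ ↓-mono i q
  ↓-mono {u} i (_◅_ {j = v} (inj₂ p) q) =
    ↓-glb v i (u ↓ i) (↓-≤ u i ◅◅ →ᴮ⇒≤ᴮ u v p)
      ([ (λ us≈v → ↓-≤ u i ◅◅ ≈⇒≤ᴮ u (v ∷ʳ i) (∷ʳ-swap u v i us≈v))
       , (λ us→vs → ↓-≤∷ʳ u i ◅◅ →ᴮ⇒≤ᴮ (u ∷ʳ i) (v ∷ʳ i) us→vs) ]′ (→ᴮ-∷ʳ-mono u v i p))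
    ◅◅ ↓-mono i q

  -- Counit of the adjunction, with `≤-↓-·ₛ` as its unit; together with `↓-mono` and `·ₛ-mono` they
  -- yield both directions of the equivalence used in `≤foldl?`.
  ·ₛ-↓-≤ : ∀ u i → (u ·ₛ i) ↓ i ≤ᴮ u
  ·ₛ-↓-≤ u i = [ (λ { (_ , eq) → subst (λ x → x ↓ i ≤ᴮ u) (sym eq)
                      (↓-≤∷ʳ (u ∷ʳ i) i ◅◅ ≈⇒≤ᴮ ((u ∷ʳ i) ∷ʳ i) u (∷ʳ-involutive u i)) })
               , (λ { (_ , eq) → subst (λ x → x ↓ i ≤ᴮ u) (sym eq) (↓-≤ u i) }) ]′ (·ₛ-spec u i)

  ≤-↓-·ₛ : ∀ u i → u ≤ᴮ (u ↓ i) ·ₛ i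
  ≤-↓-·ₛ u i = [ (λ { (_ , eq) → subst (λ x → u ≤ᴮ x ·ₛ i) (sym eq) (≤-·ₛ u i) })
               , (λ { (_ , eq) → subst (λ x → u ≤ᴮ x ·ₛ i) (sym eq)
                      (≈⇒≤ᴮ u ((u ∷ʳ i) ∷ʳ i) (≈-sym ((u ∷ʳ i) ∷ʳ i) u (∷ʳ-involutive u i))
                        ◅◅ ∷ʳ≤-·ₛ (u ∷ʳ i) i) }) ]′ (↓-spec u i)

  foldl-mono : ∀ r {u v} → u ≤ᴮ v → foldl _·ₛ_ u r ≤ᴮ foldl _·ₛ_ v r
  foldl-mono []      p = p
  foldl-mono (i ∷ r) p = foldl-mono r (·ₛ-mono i p)

  ++≤foldl : ∀ r u v → u ≤ᴮ v → u ++ r ≤ᴮ foldl _·ₛ_ v r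
  ++≤foldl []      u v p = subst (_≤ᴮ v) (sym (++-identityʳ u)) p
  ++≤foldl (i ∷ r) u v p = subst (_≤ᴮ foldl _·ₛ_ (v ·ₛ i) r) (++-assoc u (i ∷ []) r)
    (++≤foldl r (u ∷ʳ i) (v ·ₛ i) (∷ʳ≤-·ₛ u i ◅◅ ·ₛ-mono i p))

  -- By the lifting property u ≤ v · sᵢ iff u ↓ i ≤ v.
  ≤foldl? : ∀ r v → (∀ u → Dec (u ≤ᴮ v)) → ∀ u → Dec (u ≤ᴮ foldl _·ₛ_ v r)
  ≤foldl? []      v ≤v? = ≤v?
  ≤foldl? (i ∷ r) v ≤v? = ≤foldl? r (v ·ₛ i) λ u → map′
    (λ p → ≤-↓-·ₛ u i ◅◅ ·ₛ-mono i p)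
    (λ p → ↓-mono i p ◅◅ ·ₛ-↓-≤ v i)
    (≤v? (u ↓ i))

  Reduced : W → Set
  Reduced r = ∀ u → u ≈ r → length r ℕ.≤ length u

  reduced-Reduced : ∀ w → Reduced (reduced w)
  reduced-Reduced w u p = ℓ≤length w u (≈-trans u (reduced w) w p (reduced≈ w))

  length-∷ʳ : ∀ (u : W) i → length (u ∷ʳ i) ≡ suc (length u)
  length-∷ʳ u i = trans (length-++ u) (ℕ.+-comm (length u) 1)

  Reduced-init : ∀ r i → Reduced (r ∷ʳ i) → Reduced r
  Reduced-init r i red u p = ℕ.s≤s⁻¹ (subst₂ ℕ._≤_ (length-∷ʳ r i) (length-∷ʳ u i)
    (red (u ∷ʳ i) (++-congˡ u r (i ∷ []) p)))

  -- Here ℓ(r) is at most the length of `r`, which is less than the length of `r ∷ʳ i`, which is at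
  -- most ℓ(r sᵢ). Thus the edge ascends.
  Reduced-last : ∀ r i → Reduced (r ∷ʳ i) → PositiveRealRoot (r ▷ α i)
  Reduced-last r i red = Edge-ascent⁻¹ r (α i) (r ∷ʳ i) (Edge-∷ʳ r i) (ℕ.≤-<-trans
    (ℓ≤length r r (≈-refl r))
    (subst (ℕ._≤ ℓ (r ∷ʳ i)) (length-∷ʳ r i) (red (reduced (r ∷ʳ i)) (reduced≈ (r ∷ʳ i)))))

  -- The invariant of the Hecke product: it turns `w · x` back into an ordinary product `w′ x`,
  -- along which chains can be translated.
  Factor : W → W → W → Set
  Factor w r x = ∃ λ w′ → w′ ≤ᴮ w × x ≈ w′ ++ r

  Factor-extend : ∀ w r i x → Factor w r x → Factor w (r ∷ʳ i) (x ∷ʳ i)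
  Factor-extend w r i x (w′ , w′≤w , eq) = w′ , w′≤w , λ μ k →
    trans (++-congˡ x (w′ ++ r) (i ∷ []) eq μ k) (cong (λ y → (y ▷ μ) k) (++-assoc w′ r (i ∷ [])))

  -- If x sᵢ < x for x = w′ r and r sᵢ > r, then w″ = w′ (r sᵢ r⁻¹) lies below w′
  -- and x = w″ (r sᵢ).
  Factor-absorb : ∀ w r i x → PositiveRealRoot (r ▷ α i) → x ∷ʳ i →ᴮ x →
    Factor w r x → Factor w (r ∷ʳ i) x
  Factor-absorb w r i x pos (_ , xs<x) (w′ , w′≤w , eq) = w″ , →ᴮ⇒≤ᴮ w″ w′ w″→w′ ◅◅ w′≤w , eq″
    where
    t = r ▷ α i

    w″ : W
    w″ = w′ ++ ((r ∷ʳ i) ++ reverse r)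

    w″-▷ : ∀ μ → w″ ▷ μ ≡ w′ ▷ r ▷ s (α i) (reverse r ▷ μ)
    w″-▷ μ = trans (▷-++ w′ ((r ∷ʳ i) ++ reverse r) μ)
      (cong (w′ ▷_) (trans (▷-++ (r ∷ʳ i) (reverse r) μ) (∷ʳ-▷ r i (reverse r ▷ μ))))

    edge : Edge w′ t w″
    edge = pos , λ μ k → trans (cong (λ f → f k) (w″-▷ μ))
      (▷-cong w′ (r ▷ s (α i) (reverse r ▷ μ)) (s t μ) (λ l →
        trans (▷-s r (α i) (reverse r ▷ μ) l) (s-cong t t (r ▷ reverse r ▷ μ) μ (λ _ → refl) (reverse-▷ r μ) l)) k)

    negative : PositiveRealRoot (-_ ∘ (w′ ▷ t))
    negative = positive-cong (-_ ∘ (x ▷ α i)) (-_ ∘ (w′ ▷ t))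
      (λ k → cong -_ (trans (eq (α i) k) (cong (λ f → f k) (▷-++ w′ r (α i)))))
      (Edge-descent⁻¹ x (α i) (x ∷ʳ i) (Edge-∷ʳ x i) xs<x)

    w″→w′ : w″ →ᴮ w′
    w″→w′ = (t , Edge-sym w′ t w″ edge) , Edge-descent w′ t w″ edge negative

    eq″ : x ≈ w″ ++ (r ∷ʳ i)
    eq″ μ k = begin
      (x ▷ μ) k                                                  ≡⟨ eq μ k ⟩
      ((w′ ++ r) ▷ μ) k                                          ≡⟨ cong (λ f → f k) (▷-++ w′ r μ) ⟩
      (w′ ▷ r ▷ μ) k
        ≡⟨ ▷-cong w′ (r ▷ s (α i) (reverse r ▷ r ▷ s (α i) μ)) (r ▷ μ) (▷-cong r (s (α i) (reverse r ▷ r ▷ s (α i) μ)) μ λ l →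
             trans (s-cong (α i) (α i) (reverse r ▷ r ▷ s (α i) μ) (s (α i) μ) (λ _ → refl) (▷-reverse r (s (α i) μ)) l)
                   (s-invol (α i) (α-Root i) μ l)) k ⟨
      (w′ ▷ r ▷ s (α i) (reverse r ▷ r ▷ s (α i) μ)) k           ≡⟨ cong (λ f → (w′ ▷ r ▷ s (α i) (reverse r ▷ f)) k) (∷ʳ-▷ r i μ) ⟨
      (w′ ▷ r ▷ s (α i) (reverse r ▷ (r ∷ʳ i) ▷ μ)) k            ≡⟨ cong (λ f → f k) (w″-▷ ((r ∷ʳ i) ▷ μ)) ⟨
      (w″ ▷ (r ∷ʳ i) ▷ μ) k                                      ≡⟨ cong (λ f → f k) (▷-++ w″ (r ∷ʳ i) μ) ⟨
      ((w″ ++ (r ∷ʳ i)) ▷ μ) k                                   ∎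
      where open ≡-Reasoning

  -- Induction from the right end of the word: prefixes of a reduced word are reduced, and a last
  -- letter that does not lengthen the product is absorbed into `w′`.
  foldl-Factor : ∀ w r → Reduced r → Factor w r (foldl _·ₛ_ w r)
  foldl-Factor w r red = go (reverseView r) red
    where
    go : ∀ {r} → Reverse r → Reduced r → Factor w r (foldl _·ₛ_ w r)
    go [] _ = w , ε , λ μ k → cong (λ y → (y ▷ μ) k) (sym (++-identityʳ w))
    go (r ∶ rs ∶ʳ i) red = subst (Factor w (r ∷ʳ i)) (sym (foldl-∷ʳ _·ₛ_ w i r))
      ([ (λ { (_ , eq) → subst (Factor w (r ∷ʳ i)) (sym eq) (Factor-extend w r i x ih) })
       , (λ { (p , eq) → subst (Factor w (r ∷ʳ i)) (sym eq) (Factor-absorb w r i x (Reduced-last r i red) p ih) })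
       ]′ (·ₛ-spec x i))
      where
      x = foldl _·ₛ_ w r
      ih : Factor w r x
      ih = go rs (Reduced-init r i red)

  ·-Factor : ∀ w x → Factor w x (w · x)
  ·-Factor w x = reassociate (foldl-Factor w (reduced x) (reduced-Reduced x))
    where
    reassociate : Factor w (reduced x) (w · x) → Factor w x (w · x)
    reassociate (w′ , w′≤w , eq) = w′ , w′≤w ,
      ≈-trans (w · x) (w′ ++ reduced x) (w′ ++ x) eq (++-congʳ w′ (reduced x) x (reduced≈ x))

  ++≤· : ∀ u w x → u ≤ᴮ w → u ++ x ≤ᴮ w · x
  ++≤· u w x p = inj₁ (++-congʳ u x (reduced x) (≈-sym (reduced x) x (reduced≈ x))) ◅ ++≤foldl (reduced x) u w p

  -- Write `w · x` as `w′ x`, spell `x` by `q`, and compare with `++≤foldl`. This is all the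
  -- independence of the chosen word that is needed.
  ·≤foldl : ∀ w x q → q ≈ x → w · x ≤ᴮ foldl _·ₛ_ w q
  ·≤foldl w x q p = go (·-Factor w x)
    where
    go : Factor w x (w · x) → w · x ≤ᴮ foldl _·ₛ_ w q
    go (w′ , w′≤w , eq) = inj₁ (≈-trans (w · x) (w′ ++ x) (w′ ++ q) eq (++-congʳ w′ x q (≈-sym q x p))) ◅
      ++≤foldl q w′ w w′≤w

  foldl-insert : ∀ w u i v → foldl _·ₛ_ w (u ++ v) ≤ᴮ foldl _·ₛ_ w (u ++ i ∷ v)
  foldl-insert w u i v = subst₂ _≤ᴮ_ (sym (foldl-++ _·ₛ_ w u v)) (sym (foldl-++ _·ₛ_ w u (i ∷ v)))
    (foldl-mono v (≤-·ₛ (foldl _·ₛ_ w u) i))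

  -- By `exchange`, `x` is spelled by a reduced word of `y` with one letter deleted, and leaving out
  -- a letter can only lower the Hecke product.
  ·-monoʳ-→ᴮ : ∀ w x y → x →ᴮ y → w · x ≤ᴮ w · y
  ·-monoʳ-→ᴮ w x y ((γ , e@(p , _)) , x<y) = go (exchange (reduced y) γ p
      (positive-cong (-_ ∘ (y ▷ γ)) (-_ ∘ (reduced y ▷ γ)) (λ k → cong -_ (sym (reduced≈ y γ k)))
        (Edge-descent⁻¹ y γ x (Edge-sym x γ y e) x<y)))
    where
    go : Deletion (reduced y) γ → w · x ≤ᴮ w · y
    go (u , i , v , y≡ , eq) = ·≤foldl w x (u ++ v)
        (λ μ k → trans (eq μ k) (trans (reduced≈ y (s γ μ) k) (sym (Edge-s x γ y e μ k))))
      ◅◅ subst (λ r → foldl _·ₛ_ w (u ++ v) ≤ᴮ foldl _·ₛ_ w r) (sym y≡) (foldl-insert w u i v)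

  ·-monoʳ : ∀ w {x y} → x ≤ᴮ y → w · x ≤ᴮ w · y
  ·-monoʳ w ε = ε
  ·-monoʳ w {x} (_◅_ {j = y} (inj₁ p) q) = ·≤foldl w x (reduced y)
    (≈-trans (reduced y) y x (reduced≈ y) (≈-sym x y p)) ◅◅ ·-monoʳ w q
  ·-monoʳ w {x} (_◅_ {j = y} (inj₂ p) q) = ·-monoʳ-→ᴮ w x y p ◅◅ ·-monoʳ w q

  id· : ∀ x → id · x ≈ x
  id· x = go (·-Factor id x)
    where
    go : Factor id x (id · x) → id · x ≈ x
    go (w′ , w′≤id , eq) = ≈-trans (id · x) (w′ ++ x) x eq (++-congˡ w′ id x (≤ᴮ-id w′ w′≤id))

  -- Since `y ≈ id · y`, `≤foldl?` strips the letters of `y` until the bound is `id`, below which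
  -- only `id` lies.
  _≤ᴮ?_ : ∀ x y → Dec (x ≤ᴮ y)
  x ≤ᴮ? y = map′ (λ p → p ◅◅ ≈⇒≤ᴮ (id · y) y (id· y)) (λ p → p ◅◅ ≈⇒≤ᴮ y (id · y) (≈-sym (id · y) y (id· y)))
    (≤foldl? (reduced y) id (λ u → map′ (≈⇒≤ᴮ u id) (≤ᴮ-id u) (u ≈? id)) x)

-- Finiteness of the reachable set and existence of maximal elements.

sum-nonpos : ∀ {n} (f : Fin n → ℤ) → (∀ i → f i ℤ.≤ 0ℤ) → sum f ℤ.≤ 0ℤ
sum-nonpos {zero}  f f≤0 = ℤ.≤-refl
sum-nonpos {suc n} f f≤0 = ℤ.+-mono-≤ (f≤0 zero) (sum-nonpos (f ∘ suc) (f≤0 ∘ suc))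

sum-mono : ∀ {n} (f g : Fin n → ℤ) → (∀ i → f i ℤ.≤ g i) → sum f ℤ.≤ sum g
sum-mono {zero}  f g f≤g = ℤ.≤-refl
sum-mono {suc n} f g f≤g = ℤ.+-mono-≤ (f≤g zero) (sum-mono (f ∘ suc) (g ∘ suc) (f≤g ∘ suc))

sum-+-* : ∀ {n} a (f g : Fin n → ℤ) → sum (λ i → f i + a * g i) ≡ sum f + a * sum g
sum-+-* a f g = trans (∑-distrib-+ f (λ i → a * g i)) (cong (λ x → sum f + x) (sym (*-distribˡ-sum a g)))

module Finiteness (n : ℕ) (n≥3 : 3 ℕ.≤ n) where

  open AffineA n
  open Form n n≥3
  open Roots n n≥3
  open Exchange n n≥3
  open Bruhat n n≥3

  sum-α : ∀ i → sum (α i) ≡ 1ℤ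
  sum-α i = trans (sum-cong-≗ λ k → sym (ℤ.*-identityˡ (α i k))) (∑-*-indicator (λ _ → 1ℤ) i)

  sum-sub : ∀ a (μ ν : Q) → sum (λ k → μ k - a * ν k) ≡ sum μ - a * sum ν
  sum-sub a μ ν = begin
    sum (λ k → μ k - a * ν k)         ≡⟨ sum-cong-≗ (λ k → shape (μ k) a (ν k)) ⟩
    sum (λ k → μ k + - a * ν k)       ≡⟨ sum-+-* (- a) μ ν ⟩
    sum μ + - a * sum ν               ≡⟨ shape (sum μ) a (sum ν) ⟨
    sum μ - a * sum ν                 ∎
    where
    open ≡-Reasoning
    shape : ∀ x a y → x - a * y ≡ x + - a * y
    shape = solve-∀

  form-α : ∀ i ν → ⟨ α i , ν ⟩ ≡ ∑[ j < n ] (ν j * cartan i j)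
  form-α i ν = begin
    ∑[ l < n ] ∑[ j < n ] (α i l * (ν j * cartan l j))
      ≡⟨ (sum-cong-≗ λ l → sym (*-distribˡ-sum (α i l) (λ j → ν j * cartan l j))) ⟩
    ∑[ l < n ] (α i l * ∑[ j < n ] (ν j * cartan l j))
      ≡⟨ (sum-cong-≗ λ l → ℤ.*-comm (α i l) (∑[ j < n ] (ν j * cartan l j))) ⟩
    ∑[ l < n ] ((∑[ j < n ] (ν j * cartan l j)) * α i l)
      ≡⟨ ∑-*-indicator (λ l → ∑[ j < n ] (ν j * cartan l j)) i ⟩
    ∑[ j < n ] (ν j * cartan i j) ∎
    where open ≡-Reasoning

  form-expand : ∀ μ ν → ⟨ μ , ν ⟩ ≡ ∑[ i < n ] (μ i * ⟨ α i , ν ⟩)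
  form-expand μ ν = sum-cong-≗ λ i → trans (sym (*-distribˡ-sum (μ i) (λ j → ν j * cartan i j)))
    (cong (λ x → μ i * x) (sym (form-α i ν)))

  *-nonneg-nonpos : ∀ i j → 0ℤ ℤ.≤ i → j ℤ.≤ 0ℤ → i * j ℤ.≤ 0ℤ
  *-nonneg-nonpos (+ a) j _ j≤0 = subst (+ a * j ℤ.≤_) (ℤ.*-zeroʳ (+ a)) (ℤ.*-monoˡ-≤-nonNeg (+ a) j≤0)

  -- In 2 = ⟨γ,γ⟩ = Σ γᵢ⟨αᵢ,γ⟩ all γᵢ are nonnegative, so some ⟨αᵢ,γ⟩ must be positive; the finite
  -- search provides the index.
  descent-direction : ∀ γ → PositiveRealRoot γ → ∃ λ i → 0ℤ ℤ.< ⟨ α i , γ ⟩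
  descent-direction γ p = by-cases (Fin.any? λ i → 0ℤ ℤ.<? ⟨ α i , γ ⟩)
    where
    by-cases : Dec (∃ λ i → 0ℤ ℤ.< ⟨ α i , γ ⟩) → ∃ λ i → 0ℤ ℤ.< ⟨ α i , γ ⟩
    by-cases (yes found) = found
    by-cases (no none) = contradiction
      (subst (ℤ._≤ 0ℤ) (trans (sym (form-expand γ γ)) (positive⇒Root γ p))
        (sum-nonpos (λ i → γ i * ⟨ α i , γ ⟩) λ i → *-nonneg-nonpos (γ i) ⟨ α i , γ ⟩ (positive⇒nonneg γ p i)
          (ℤ.≮⇒≥ λ 0< → none (i , 0<))))
      λ { (+≤+ ()) }

  -- `Edge` only relates vertices that are given as words, so listing the neighbours of `id`
  -- requires a word for each reflection.
  Word : Q → Set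
  Word γ = ∃ λ w → ∀ μ → w ▷ μ ≗ s γ μ

  Word-α : ∀ i γ → γ ≗ α i → Word γ
  Word-α i γ eq = i ∷ [] , λ μ → s-cong (α i) γ μ μ (λ k → sym (eq k)) (λ _ → refl)

  Word-conjugate : ∀ i γ → Word (s (α i) γ) → Word γ
  Word-conjugate i γ (w , eq) = i ∷ (w ∷ʳ i) , λ μ k → begin
    s (α i) ((w ∷ʳ i) ▷ μ) k
      ≡⟨ s-cong (α i) (α i) ((w ∷ʳ i) ▷ μ) (s (s (α i) γ) (s (α i) μ)) (λ _ → refl)
           (λ l → trans (cong (λ f → f l) (∷ʳ-▷ w i μ)) (eq (s (α i) μ) l)) k ⟩
    s (α i) (s (s (α i) γ) (s (α i) μ)) k
      ≡⟨ ▷-s (i ∷ []) (s (α i) γ) (s (α i) μ) k ⟩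
    s (s (α i) (s (α i) γ)) (s (α i) (s (α i) μ)) k
      ≡⟨ s-cong (s (α i) (s (α i) γ)) γ (s (α i) (s (α i) μ)) μ
           (s-invol (α i) (α-Root i) γ) (s-invol (α i) (α-Root i) μ) k ⟩
    s γ μ k ∎
    where open ≡-Reasoning

  -- Induction on the height `sum γ`, bounded by `h`: a simple reflection with ⟨αᵢ,γ⟩ > 0 lowers the
  -- height and keeps γ positive unless γ = αᵢ, and s_γ is the conjugate by sᵢ of the reflection in
  -- sᵢγ.
  reflection-word : ∀ h γ → PositiveRealRoot γ → sum γ ℤ.≤ + h → Word γ
  reflection-word zero    γ p bound = contradiction (ℤ.≤-trans (1≤sum-positive γ p) bound) λ { (+≤+ ()) }
  reflection-word (suc h) γ p bound = by-direction (descent-direction γ p)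
    where
    by-direction : (∃ λ i → 0ℤ ℤ.< ⟨ α i , γ ⟩) → Word γ
    by-direction (i , 0<) = [ Word-α i γ , (λ q → Word-conjugate i γ (reflection-word h (s (α i) γ) q smaller)) ]′
      (sα-positive i γ p)
      where
      open ℤ.≤-Reasoning
      smaller : sum (s (α i) γ) ℤ.≤ + h
      smaller = begin
        sum (s (α i) γ)                   ≡⟨ sum-sub ⟨ γ , α i ⟩ γ (α i) ⟩
        sum γ - ⟨ γ , α i ⟩ * sum (α i)   ≡⟨ cong (λ x → sum γ - x) (trans (cong (λ x → ⟨ γ , α i ⟩ * x) (sum-α i))
                                              (trans (ℤ.*-identityʳ ⟨ γ , α i ⟩) (form-sym γ (α i)))) ⟩
        sum γ - ⟨ α i , γ ⟩               ≤⟨ ℤ.+-mono-≤ bound (ℤ.neg-mono-≤ (ℤ.i<j⇒suc[i]≤j 0<)) ⟩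
        + suc h - 1ℤ                      ≡⟨⟩
        + h                               ∎

  word : ∀ γ → PositiveRealRoot γ → Word γ
  word γ p = reflection-word ∣ sum γ ∣ γ p
    (ℤ.≤-reflexive (sym (ℤ.0≤i⇒+∣i∣≡i (sum-nonneg γ (positive⇒nonneg γ p)))))

  positive? : ∀ γ → Dec (PositiveRealRoot γ)
  positive? γ = map′ (λ { (r , 0≤γ) → nonneg-Root⇒positive γ r 0≤γ })
    (λ p → positive⇒Root γ p , positive⇒nonneg γ p)
    ((⟨ γ , γ ⟩ ℤ.≟ + 2) ×-dec Fin.all? λ k → 0ℤ ℤ.≤? γ k)

  Chain-nonneg : ∀ {u v δ} → Chain u v δ → ∀ k → 0ℤ ℤ.≤ δ k
  Chain-nonneg (nil _)            k = ℤ.≤-refl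
  Chain-nonneg (cons {γ = γ} (p , _) ch) k = ℤ.+-mono-≤ (positive⇒nonneg γ p k) (Chain-nonneg ch k)

  Chain-congˡ : ∀ {u u′ v δ} → u′ ≈ u → Chain u v δ → Chain u′ v δ
  Chain-congˡ {u} {u′} {v} p (nil q) = nil (≈-trans u′ u v p q)
  Chain-congˡ p (cons {γ = γ} (pos , eq) ch) = cons (pos , λ μ k → trans (eq μ k) (sym (p (s γ μ) k))) ch

  Chain-congʳ : ∀ {u v v′ δ} → v ≈ v′ → Chain u v δ → Chain u v′ δ
  Chain-congʳ {u} {v} {v′} p (nil q) = nil (≈-trans u v v′ q p)
  Chain-congʳ p (cons e ch) = cons e (Chain-congʳ p ch)

  Edge-++ : ∀ w u γ v → Edge u γ v → Edge (w ++ u) γ (w ++ v)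
  Edge-++ w u γ v (p , eq) = p , λ μ k → trans (cong (λ f → f k) (▷-++ w v μ))
    (trans (▷-cong w (v ▷ μ) (u ▷ s γ μ) (eq μ) k) (cong (λ f → f k) (sym (▷-++ w u (s γ μ)))))

  -- Edges multiply by s_γ on the right, so left translation preserves them together with their
  -- degrees.
  Chain-++ : ∀ w {u v δ} → Chain u v δ → Chain (w ++ u) (w ++ v) δ
  Chain-++ w {u} {v} (nil p) = nil (++-congʳ w u v p)
  Chain-++ w {u} (cons {v = v} {γ = γ} e ch) = cons (Edge-++ w u γ v e) (Chain-++ w ch)

  ++-reverse≈ : ∀ w v → w ++ (reverse w ++ v) ≈ v
  ++-reverse≈ w v μ k = trans (cong (λ f → f k) (trans (▷-++ w (reverse w ++ v) μ) (cong (w ▷_) (▷-++ (reverse w) v μ))))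
    (reverse-▷ w (v ▷ μ) k)

  reverse-≈ : ∀ w v → v ≈ w → reverse w ++ v ≈ id
  reverse-≈ w v p μ k = trans (cong (λ f → f k) (▷-++ (reverse w) v μ))
    (trans (▷-cong (reverse w) (v ▷ μ) (w ▷ μ) (p μ) k) (▷-reverse w μ k))

  -- Reachability from `id` with the bound in `Q` rather than in `Degree`, so that subtracting the
  -- degree of an edge involves no truncation.
  Within : Q → W → Set
  Within d x = ∃ λ δ → Chain id x δ × (∀ k → δ k ℤ.≤ d k)

  -- Soundness and completeness refer to different predicates: the list for one first edge has to
  -- contain all elements reached through it, but its members only have to lie in the whole set.
  Cover : (W → Set) → (W → Set) → Set
  Cover P R = ∃ λ L → All P L × (∀ x → R x → Any (x ≈_) L)

  Via : Q → Q → W → Set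
  Via d γ x = ∃ λ v → ∃ λ δ → Edge id γ v × Chain v x δ × (∀ k → γ k + δ k ℤ.≤ d k)

  infixl 6 _⊖_
  _⊖_ : Q → Q → Q
  (d ⊖ γ) k = d k - γ k

  sum-⊖ : ∀ d γ → sum (d ⊖ γ) ≡ sum d - sum γ
  sum-⊖ d γ = begin
    sum (λ k → d k - γ k)          ≡⟨ sum-cong-≗ (λ k → cong (λ x → d k - x) (sym (ℤ.*-identityˡ (γ k)))) ⟩
    sum (λ k → d k - 1ℤ * γ k)     ≡⟨ sum-sub 1ℤ d γ ⟩
    sum d - 1ℤ * sum γ             ≡⟨ cong (λ x → sum d - x) (ℤ.*-identityˡ (sum γ)) ⟩
    sum d - sum γ                  ∎
    where open ≡-Reasoning

  Via-cong : ∀ d γ γ′ x → γ ≗ γ′ → Via d γ x → Via d γ′ x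
  Via-cong d γ γ′ x p (v , δ , (pos , eq) , ch , le) =
    v , δ , (positive-cong γ γ′ p pos , λ μ k → trans (eq μ k) (s-cong γ γ′ μ μ p (λ _ → refl) k)) , ch ,
    λ k → subst (λ y → y + δ k ℤ.≤ d k) (p k) (le k)

  Via⇒≤ : ∀ d γ x → Via d γ x → ∀ k → γ k ℤ.≤ d k
  Via⇒≤ d γ x (_ , _ , _ , ch , le) k = ℤ.≤-trans (nonneg-summandˡ (Chain-nonneg ch k)) (le k)

  move : ∀ {a b c} → a + b ℤ.≤ c → b ℤ.≤ c - a
  move {a} {b} {c} p = subst (ℤ._≤ c - a) (cancel a b) (ℤ.+-monoˡ-≤ (- a) p)
    where
    cancel : ∀ a b → a + b - a ≡ b
    cancel = solve-∀

  unmove : ∀ {a b c} → b ℤ.≤ c - a → a + b ℤ.≤ c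
  unmove {a} {b} {c} p = subst (a + b ℤ.≤_) (cancel a c) (ℤ.+-monoʳ-≤ a p)
    where
    cancel : ∀ a c → a + (c - a) ≡ c
    cancel = solve-∀

  -- Translation by s_γ: what is reached through a first edge of degree γ is s_γ times what is
  -- reached from `id` within the remaining degree.
  cover-via : ∀ d γ → PositiveRealRoot γ → Word γ → Cover (Within (d ⊖ γ)) (Within (d ⊖ γ)) →
    Cover (Within d) (Via d γ)
  cover-via d γ p (w , w≈) (L , sound , complete) = map (w ++_) L , All.map⁺ (All.map sound′ sound) , complete′
    where
    sound′ : ∀ {y} → Within (d ⊖ γ) y → Within d (w ++ y)
    sound′ (δ , ch , le) = (λ k → γ k + δ k) ,
      cons {v = w} (p , w≈)
        (Chain-congˡ {w ++ id} {w} (λ μ k → cong (λ f → f k) (sym (▷-++ w [] μ))) (Chain-++ w ch)) ,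
      λ k → unmove (le k)

    complete′ : ∀ x → Via d γ x → Any (x ≈_) (map (w ++_) L)
    complete′ x (v , δ , (_ , eq) , ch , le) = Any.map⁺ (Any.map
      (λ {l} y≈l → ≈-trans x (w ++ (reverse w ++ x)) (w ++ l)
        (≈-sym (w ++ (reverse w ++ x)) x (++-reverse≈ w x)) (++-congʳ w (reverse w ++ x) l y≈l))
      (complete (reverse w ++ x) (δ ,
        Chain-congˡ {reverse w ++ v} {id} (≈-sym (reverse w ++ v) id (reverse-≈ w v λ μ k → trans (eq μ k) (sym (w≈ μ k))))
          (Chain-++ (reverse w) ch) ,
        λ k → move (le k))))

  -- One `Fin` type enumerates all vectors with coordinates below `N`. In `cover` the base is
  -- `suc h`, because every coordinate of γ is at most `sum d`, hence at most `h`.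
  decode : ∀ {N} → Fin (N ℕ.^ n) → Q
  decode code k = + toℕ (finToFun code k)

  encode : ∀ N (γ : Q) → (∀ k → 0ℤ ℤ.≤ γ k) → (∀ k → γ k ℤ.< + N) → ∃ λ (code : Fin (N ℕ.^ n)) → γ ≗ decode code
  encode N γ 0≤γ γ<N = funToFin digit , λ k → sym (begin
    + toℕ (finToFun (funToFin digit) k)  ≡⟨ cong (λ i → + toℕ i) (Fin.finToFun-funToFin digit k) ⟩
    + toℕ (digit k)                      ≡⟨ cong +_ (Fin.toℕ-fromℕ< (bound k)) ⟩
    + ∣ γ k ∣                            ≡⟨ ℤ.0≤i⇒+∣i∣≡i (0≤γ k) ⟩
    γ k                                  ∎)
    where
    open ≡-Reasoning
    bound : ∀ k → ∣ γ k ∣ ℕ.< N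
    bound k = ℤ.drop‿+<+ (subst (ℤ._< + N) (sym (ℤ.0≤i⇒+∣i∣≡i (0≤γ k))) (γ<N k))
    digit : Fin n → Fin N
    digit k = fromℕ< (bound k)

  -- The first edge of a nonempty chain has degree γ ≤ d, so γ is one of finitely
  -- many vectors, and the remaining chain has degree ≤ d - γ.
  cover : ∀ h d → (∀ k → 0ℤ ℤ.≤ d k) → sum d ℤ.≤ + h → Cover (Within d) (Within d)
  cover-step : ∀ h d → (∀ k → 0ℤ ℤ.≤ d k) → sum d ℤ.≤ + h → ∀ γ → Cover (Within d) (Via d γ)

  cover h d 0≤d bound = [] ∷ concat (tabulate list) ,
      ((λ _ → 0ℤ) , nil (≈-refl id) , 0≤d) ∷ All.concat⁺ (All.tabulate⁺ λ c → proj₁ (proj₂ (covers c))) ,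
      complete
    where
    covers : (c : Fin (suc h ℕ.^ n)) → Cover (Within d) (Via d (decode c))
    covers c = cover-step h d 0≤d bound (decode c)

    list : Fin (suc h ℕ.^ n) → List W
    list c = proj₁ (covers c)

    complete : ∀ x → Within d x → Any (x ≈_) ([] ∷ concat (tabulate list))
    complete x (_ , nil p , _) = here (≈-sym id x p)
    complete x (_ , cons {v = v} {γ = γ} {δ = δ} e ch , le) = there (found (encode (suc h) γ
        (positive⇒nonneg γ (proj₁ e)) λ k → ℤ.≤-<-trans (Via⇒≤ d γ x via k)
          (ℤ.≤-<-trans (ℤ.≤-trans (coordinate≤sum d 0≤d k) bound) (ℤ.+<+ ℕ.≤-refl))))
      where
      via : Via d γ x
      via = v , δ , e , ch , le

      found : (∃ λ c → γ ≗ decode c) → Any (x ≈_) (concat (tabulate list))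
      found (c , eq) = Any.concat⁺ (Any.tabulate⁺ c (proj₂ (proj₂ (covers c)) x (Via-cong d γ (decode c) x eq via)))

  cover-step h d 0≤d bound γ = by-cases h bound (positive? γ) (Fin.all? λ k → γ k ℤ.≤? d k)
    where
    by-cases : ∀ h → sum d ℤ.≤ + h → Dec (PositiveRealRoot γ) → Dec (∀ k → γ k ℤ.≤ d k) → Cover (Within d) (Via d γ)
    by-cases h       bound (no ¬p) _        = [] , [] , λ { x (_ , _ , (p , _) , _) → contradiction p ¬p }
    by-cases h       bound (yes p) (no ¬le) = [] , [] , λ x via → contradiction (Via⇒≤ d γ x via) ¬le
    by-cases zero    bound (yes p) (yes le) = contradiction
      (ℤ.≤-trans (1≤sum-positive γ p) (ℤ.≤-trans (sum-mono γ d le) bound)) λ { (+≤+ ()) }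
    -- A positive root has height at least 1, so the remaining degree fits the smaller bound `h`.
    by-cases (suc h) bound (yes p) (yes le) = cover-via d γ p (word γ p) (cover h (d ⊖ γ) (λ k → ℤ.i≤j⇒0≤j-i (le k)) smaller)
      where
      open ℤ.≤-Reasoning
      smaller : sum (d ⊖ γ) ℤ.≤ + h
      smaller = begin
        sum (d ⊖ γ)       ≡⟨ sum-⊖ d γ ⟩
        sum d - sum γ     ≤⟨ ℤ.+-mono-≤ bound (ℤ.neg-mono-≤ (1≤sum-positive γ p)) ⟩
        + suc h - 1ℤ      ≡⟨⟩
        + h               ∎

  -- One pass is enough: an entry `l` with `x ≰ l` cannot lie above the final `m`, since x ≤ m ≤ l
  -- would follow.
  dominate : ∀ {P : W → Set} L → All P L → ∀ x → P x →
    ∃ λ m → P m × x ≤ᴮ m × All (λ l → m ≤ᴮ l → l ≤ᴮ m) L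
  dominate [] [] x Px = x , Px , ε , []
  dominate {P} (l ∷ L) (Pl ∷ PL) x Px = by-cases (x ≤ᴮ? l)
    where
    by-cases : Dec (x ≤ᴮ l) → ∃ λ m → P m × x ≤ᴮ m × All (λ l → m ≤ᴮ l → l ≤ᴮ m) (l ∷ L)
    by-cases (yes x≤l) = extend (dominate L PL l Pl)
      where
      extend : (∃ λ m → P m × l ≤ᴮ m × All (λ l → m ≤ᴮ l → l ≤ᴮ m) L) →
        ∃ λ m → P m × x ≤ᴮ m × All (λ l → m ≤ᴮ l → l ≤ᴮ m) (l ∷ L)
      extend (m , Pm , l≤m , maximal) = m , Pm , x≤l ◅◅ l≤m , (λ _ → l≤m) ∷ maximal
    by-cases (no x≰l) = extend (dominate L PL x Px)
      where
      extend : (∃ λ m → P m × x ≤ᴮ m × All (λ l → m ≤ᴮ l → l ≤ᴮ m) L) →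
        ∃ λ m → P m × x ≤ᴮ m × All (λ l → m ≤ᴮ l → l ≤ᴮ m) (l ∷ L)
      extend (m , Pm , x≤m , maximal) = m , Pm , x≤m , (λ m≤l → contradiction (x≤m ◅◅ m≤l) x≰l) ∷ maximal

  Cover⇒Max : ∀ {P : W → Set} → Cover P P → ∀ x → P x → ∃ λ m → m ∈ Max P × x ≤ᴮ m
  Cover⇒Max {P} (L , sound , complete) x Px = finish (dominate L sound x Px)
    where
    finish : (∃ λ m → P m × x ≤ᴮ m × All (λ l → m ≤ᴮ l → l ≤ᴮ m) L) → ∃ λ m → m ∈ Max P × x ≤ᴮ m
    finish (m , Pm , x≤m , maximal) = m , (Pm , λ y Py m≤y → at-cover y m≤y (Any.lookup (complete y Py)) (All.lookupAny maximal (complete y Py))) , x≤m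
      where
      at-cover : ∀ y → m ≤ᴮ y → ∀ l → (m ≤ᴮ l → l ≤ᴮ m) × y ≈ l → y ≈ m
      at-cover y m≤y l (below , y≈l) = ≤ᴮ-antisym (≈⇒≤ᴮ y l y≈l ◅◅ below (m≤y ◅◅ ≈⇒≤ᴮ y l y≈l)) m≤y

  -- Comparison of the elements reachable from `id` and from `w`.

  ι : Degree → Q
  ι d k = + d k

  Reachable-id⇒Within : ∀ d x → Reachable d id x → Within (ι d) x
  Reachable-id⇒Within d x (u′ , u′≤id , δ , ch , le) = δ , Chain-congˡ (≈-sym u′ id (≤ᴮ-id u′ u′≤id)) ch , le

  Within⇒Reachable-id : ∀ d x → Within (ι d) x → Reachable d id x
  Within⇒Reachable-id d x (δ , ch , le) = id , ε , δ , ch , le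

  Reachable-cover : ∀ d → Cover (Reachable d id) (Reachable d id)
  Reachable-cover d = convert (cover ∣ sum (ι d) ∣ (ι d) (λ k → +≤+ z≤n)
      (ℤ.≤-reflexive (sym (ℤ.0≤i⇒+∣i∣≡i (sum-nonneg (ι d) λ k → +≤+ z≤n)))))
    where
    convert : Cover (Within (ι d)) (Within (ι d)) → Cover (Reachable d id) (Reachable d id)
    convert (L , sound , complete) = L , All.map (λ {x} → Within⇒Reachable-id d x) sound ,
      λ x r → complete x (Reachable-id⇒Within d x r)

  Γ-id-dominates : ∀ d x → Reachable d id x → ∃ λ u → u ∈ Γ d id × x ≤ᴮ u
  Γ-id-dominates d = Cover⇒Max (Reachable-cover d)

  Reachable-congʳ : ∀ d u v v′ → v ≈ v′ → Reachable d u v → Reachable d u v′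
  Reachable-congʳ d u v v′ p (u′ , u′≤u , δ , ch , le) = u′ , u′≤u , δ , Chain-congʳ p ch , le

  Reachable⇒≤· : ∀ d w v → Reachable d w v → ∃ λ x → Reachable d id x × v ≤ᴮ w · x
  Reachable⇒≤· d w v (u′ , u′≤w , δ , ch , le) = reverse u′ ++ v ,
    (reverse u′ ++ u′ , ≈⇒≤ᴮ (reverse u′ ++ u′) id (reverse-≈ u′ u′ (≈-refl u′)) , δ , Chain-++ (reverse u′) ch , le) ,
    ≈⇒≤ᴮ v (u′ ++ (reverse u′ ++ v)) (≈-sym (u′ ++ (reverse u′ ++ v)) v (++-reverse≈ u′ v))
      ◅◅ ++≤· u′ w (reverse u′ ++ v) u′≤w

  -- As `w · x = w′ x` with `w′ ≤ w`, the chain for `x` translated by `w′` starts below `w`, which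
  -- is all that `Reachable` demands of its starting point.
  ·-Reachable : ∀ d w x → Reachable d id x → Reachable d w (w · x)
  ·-Reachable d w x (u , u≤id , δ , ch , le) = via (·-Factor w x)
    where
    via : Factor w x (w · x) → Reachable d w (w · x)
    via (w′ , w′≤w , eq) = w′ ++ u , ≈⇒≤ᴮ (w′ ++ u) w′ w′u≈w′ ◅◅ w′≤w , δ ,
      Chain-congʳ (≈-sym (w · x) (w′ ++ x) eq) (Chain-++ w′ ch) , le
      where
      w′u≈w′ : w′ ++ u ≈ w′
      w′u≈w′ μ k = trans (++-congʳ w′ u id (≤ᴮ-id u u≤id) μ k) (cong (λ f → f k) (▷-++ w′ [] μ))

  Translates : Degree → W → W → Set
  Translates d w x = ∃ λ u → u ∈ Γ d id × x ≈ w · u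

  Translates⇒Reachable : ∀ d w x → Translates d w x → Reachable d w x
  Translates⇒Reachable d w x (u , (r , _) , eq) =
    Reachable-congʳ d w (w · u) x (≈-sym x (w · u) eq) (·-Reachable d w u r)

  Reachable⇒≤Translates : ∀ d w v → Reachable d w v → ∃ λ u → u ∈ Γ d id × v ≤ᴮ w · u
  Reachable⇒≤Translates d w v r = outer (Reachable⇒≤· d w v r)
    where
    outer : (∃ λ x → Reachable d id x × v ≤ᴮ w · x) → ∃ λ u → u ∈ Γ d id × v ≤ᴮ w · u
    outer (x , rx , v≤wx) = inner (Γ-id-dominates d x rx)
      where
      inner : (∃ λ u → u ∈ Γ d id × x ≤ᴮ u) → ∃ λ u → u ∈ Γ d id × v ≤ᴮ w · u
      inner (u , u∈Γ , x≤u) = u , u∈Γ , v≤wx ◅◅ ·-monoʳ w x≤u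

  -- Translates are reachable and every reachable element lies below a translate, so a maximal
  -- reachable element equals the translate above it. `Max⊆Γ` closes the same sandwich by
  -- antisymmetry.
  Γ⊆Max : ∀ d w {v} → v ∈ Γ d w → v ∈ Max (Translates d w)
  Γ⊆Max d w {v} (r , maximal) = translate (Reachable⇒≤Translates d w v r) ,
    λ x t v≤x → maximal x (Translates⇒Reachable d w x t) v≤x
    where
    translate : (∃ λ u → u ∈ Γ d id × v ≤ᴮ w · u) → Translates d w v
    translate (u , u∈Γ , v≤wu) = u , u∈Γ ,
      ≈-sym (w · u) v (maximal (w · u) (·-Reachable d w u (proj₁ u∈Γ)) v≤wu)

  Max⊆Γ : ∀ d w {v} → v ∈ Max (Translates d w) → v ∈ Γ d w
  Max⊆Γ d w {v} (t , maximal) = Translates⇒Reachable d w v t , λ y r v≤y →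
    bounded y v≤y (Reachable⇒≤Translates d w y r)
    where
    bounded : ∀ y → v ≤ᴮ y → (∃ λ u → u ∈ Γ d id × y ≤ᴮ w · u) → y ≈ v
    bounded y v≤y (u , u∈Γ , y≤wu) = ≤ᴮ-antisym
      (y≤wu ◅◅ ≈⇒≤ᴮ (w · u) v (maximal (w · u) (u , u∈Γ , ≈-refl (w · u)) (v≤y ◅◅ y≤wu))) v≤y

theorem1p4 : (n : ℕ) → 3 ≤ n → let open AffineA n in
    (w : W) (d : Degree) →
    Γ d w ≐ Max (λ x → ∃ λ u → u ∈ Γ d id × x ≈ w · u)
theorem1p4 n n≥3 w d = Finiteness.Γ⊆Max n n≥3 d w , Finiteness.Max⊆Γ n n≥3 d w
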